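{- There exists a constant $0<\alpha\le 1$ such that for every $\Delta$ and every graph $G=(V,E)$ with maximum degree at most $\Delta$, there is a partition $(A,B)$ of $V$ such that $tw(G[A])\ge \left\lfloor\frac{\alpha\,tw(G)}{\Delta^2}\right\rfloor$ and $tw(G[B])\ge \left\lfloor\frac{\alpha\,tw(G)}{\Delta^2}\right\rfloor$.
   Context: Graphs are undirected, without self-loops, possibly with parallel edges. $tw$ denotes treewidth and $G[A]$ the subgraph induced by the vertex set $A$. -}

module Defs where

open import Data.Nat using (ℕ; zero; suc; _⊔_; _∸_; _/_; _≤_)
open import Data.Fin using (Fin; zero; suc; inject₁; toℕ)
open import Data.Fin.Subset using (Subset; _∈_; _∉_; ∣_∣; ⊤)
open import Data.Product using (_×_; _,_; proj₁; proj₂)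
open import Data.Sum using (_⊎_)
open import Data.List using (List; length; filter; map; foldr; allFin)
open import Data.List.Relation.Unary.All using (All)
open import Relation.Binary.PropositionalEquality using (_≡_; _≢_)
open import Relation.Nullary using (¬_)
open import Relation.Nullary.Decidable using (_⊎-dec_)
open import Data.Fin.Properties using (_≟_)

-- Finite undirected graphs without self-loops, parallel edges allowed.
-- Vertices are Fin n; each edge is an (unordered) pair stored as a list entry.

record Graph : Set where
  field
    n       : ℕ
    edges   : List (Fin n × Fin n)
    noLoops : All (λ e → proj₁ e ≢ proj₂ e) edges
open Graph public

degree : (G : Graph) → Fin (n G) → ℕ
degree G v = length (filter (λ e → (proj₁ e ≟ v) ⊎-dec (proj₂ e ≟ v)) (edges G))

MaxDegreeAtMost : Graph → ℕ → Set
MaxDegreeAtMost G Δ = ∀ v → degree G v ≤ Δ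

-- Finite nonempty trees on nodes Fin (suc m), encoded by parent pointers:
-- node (suc i) has parent (par i), whose index is at most i.
-- (Every finite nonempty tree has such an encoding, e.g. via BFS order.)

record Tree : Set where
  field
    m      : ℕ
    par    : Fin m → Fin (suc m)
    parLt  : ∀ i → toℕ (par i) ≤ toℕ i
open Tree public

data TAdj (T : Tree) : Fin (suc (m T)) → Fin (suc (m T)) → Set where
  up   : ∀ i → TAdj T (suc i) (par T i)
  down : ∀ i → TAdj T (par T i) (suc i)

data Reach (T : Tree) (S : Fin (suc (m T)) → Set) (i : Fin (suc (m T)))
     : Fin (suc (m T)) → Set where
  here : S i → Reach T S i i
  step : ∀ {k l} → Reach T S i k → TAdj T k l → S l → Reach T S i l

-- Tree decompositions of an induced subgraph G[A], A ⊆ V(G).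
-- G[A] has vertex set A and the edges of G with both ends in A.

record TreeDecomposition (G : Graph) (A : Subset (n G)) : Set where
  field
    tree     : Tree
    bag      : Fin (suc (m tree)) → Subset (n G)
    bagInA   : ∀ t v → v ∈ bag t → v ∈ A
    covers   : ∀ v → v ∈ A → Data.Product.Σ (Fin (suc (m tree))) (λ t → v ∈ bag t)
    edgeCov  : All (λ e → proj₁ e ∈ A → proj₂ e ∈ A →
                 Data.Product.Σ (Fin (suc (m tree)))
                   (λ t → (proj₁ e ∈ bag t) × (proj₂ e ∈ bag t))) (edges G)
    connected : ∀ v i j → v ∈ bag i → v ∈ bag j → Reach tree (λ t → v ∈ bag t) i j
open TreeDecomposition public

width : ∀ {G A} → TreeDecomposition G A → ℕ
width D = foldr _⊔_ 0 (map (λ t → ∣ bag D t ∣) (allFin (suc (m (tree D))))) ∸ 1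

TwAtLeast : (G : Graph) → Subset (n G) → ℕ → Set
TwAtLeast G A k = (D : TreeDecomposition G A) → k ≤ width D

TwEq : (G : Graph) → Subset (n G) → ℕ → Set
TwEq G A k = Data.Product.Σ (TreeDecomposition G A) (λ D → width D ≡ k) × TwAtLeast G A k

Treewidth : (G : Graph) → ℕ → Set
Treewidth G k = TwEq G ⊤ k

_div_ : ℕ → ℕ → ℕ
a div zero = 0
a div suc b = a / suc b

IsPartition : (G : Graph) → Subset (n G) → Subset (n G) → Set
IsPartition G A B = (∀ v → v ∈ A ⊎ v ∈ B) × (∀ v → v ∈ A → v ∉ B)

{-# OPTIONS --safe #-}

-- Let w be the target and call a vertex set small if its induced subgraph has treewidth below w. If no
-- partition has two large sides, then of any two disjoint sets one is small. Consider the partitions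
-- A ∪ B = V with both sides of treewidth at most w, and count their crossing edges.
--
-- While there are more than 1141 (w + 1) Δ² of them, they can be decreased. Balanced separators (a bag
-- each, so O(wΔ) edges) halve A = A₁ ∪ A₂ and B = B₁ ∪ B₂ in such a way that e(A₂,B₂) and e(A₁,B₁) are
-- both a constant fraction of e(A,B). One of A₂ ∪ B₂ and A₁ ∪ B₁ is small, say the first. Distribute A₁
-- between A₂ ∪ B₂ and B₁: bisect A₁ repeatedly, always giving one half to a side that stays small, until
-- the undecided part has only O(wΔ) edges to its outside; then move its boundary vertices one by one
-- until the growing side just stops being small. Both sides again have treewidth at most w, the edges
-- between A₂ and B₂ no longer cross, and only O(wΔ²) plus a small fraction of e(A,B) new edges do.
--
-- At the end the ends of O(wΔ²) crossing edges can be deleted to split V into two parts of treewidth at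
-- most w, so the treewidth of the whole graph is O(wΔ²), a contradiction.

module Submission where

open import Defs
open import Data.Nat using (ℕ; _*_; _≤_; _<_)
open import Data.Product using (Σ; _×_)
open import Data.Fin.Subset using (Subset)

open import Data.Bool using (if_then_else_)
open import Data.Empty using (⊥-elim)
open import Data.Fin using (Fin; zero; suc; toℕ; fromℕ<; _≟_)
open import Data.Fin.Properties using (any?; all?; toℕ-injective; toℕ<n; toℕ-fromℕ<)
open import Data.Fin.Subset hiding (Subset)
open import Data.Fin.Subset.Properties
open import Data.List using (List; []; _∷_; map; foldr; allFin; filter; length)
open import Data.List.Membership.Propositional using () renaming (_∈_ to _∈ˡ_)
open import Data.List.Membership.Propositional.Properties using (∈-map⁺; ∈-allFin)
open import Data.List.Relation.Unary.All as All using (All; []; _∷_)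
open import Data.List.Relation.Unary.All.Properties using () renaming (map⁺ to All-map⁺)
open import Data.List.Relation.Unary.Any using (here; there)
open import Data.Nat using (zero; suc; _+_; _∸_; _⊔_; z≤n; s≤s; _≤?_; _<?_)
import Data.Nat as ℕ
open import Data.Nat.DivMod using (m/n*n≤m)
open import Data.Nat.Properties hiding (_≟_)
open import Data.Nat.Tactic.RingSolver using (solve-∀)
open import Data.Product using (∃; _,_; proj₁; proj₂)
open import Data.Sum using (_⊎_; inj₁; inj₂; [_,_])
open import Data.Vec using ([]; _∷_; here; there; tabulate)
open import Data.Vec.Properties using (lookup∘tabulate; lookup⇒[]=; []=⇒lookup)
open import Function using (_∘_; case_of_; id)
open import Relation.Binary.Definitions using (DecidableEquality)
open import Relation.Binary.PropositionalEquality hiding ([_])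
open import Relation.Nullary
open import Relation.Nullary.Decidable using (dec-true; dec-false; _×-dec_; _⊎-dec_; _→-dec_; ¬?)
open import Relation.Unary using (Decidable)
import Algebra.Properties.Semiring.Sum +-*-semiring as Sum
open Sum using (sum; ∑-distrib-+; ∑-comm)

private variable ν : ℕ

-- Finite sets and weights

x∈p─q⇒x∈p : ∀ {p q : Subset ν} {x} → x ∈ p ─ q → x ∈ p
x∈p─q⇒x∈p {p = p} {q} = p─q⊆p p q

x∈p─q⇒x∉q : ∀ {p q : Subset ν} {x} → x ∈ p ─ q → x ∉ q
x∈p─q⇒x∉q {p = _ ∷ _} {inside ∷ _} () here
x∈p─q⇒x∉q {p = _ ∷ _} {_ ∷ _} (there x∈) (there x∈q) = x∈p─q⇒x∉q x∈ x∈q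

x∈p-y⇒x≢y : ∀ {p : Subset ν} {x y} → x ∈ p - y → x ≢ y
x∈p-y⇒x≢y x∈ refl = x∈p─q⇒x∉q x∈ (x∈⁅x⁆ _)

⟪_⟫ : ∀ {P : Fin ν → Set} → Decidable P → Subset ν
⟪ P? ⟫ = tabulate (does ∘ P?)

∈⟪⟫⁺ : ∀ {P : Fin ν → Set} (P? : Decidable P) {x} → P x → x ∈ ⟪ P? ⟫
∈⟪⟫⁺ P? {x} px = lookup⇒[]= x _ (trans (lookup∘tabulate _ x) (dec-true (P? x) px))

∈⟪⟫⁻ : ∀ {P : Fin ν → Set} (P? : Decidable P) {x} → x ∈ ⟪ P? ⟫ → P x
∈⟪⟫⁻ P? {x} x∈ with P? x | trans (sym (lookup∘tabulate (does ∘ P?) x)) ([]=⇒lookup x∈)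
... | yes px | _ = px
... | no _ | ()

∈∪-either : ∀ {p q : Subset ν} {x} → x ∈ p ∪ q → x ∈ p ⊎ x ∈ q
∈∪-either = x∈p∪q⁻ _ _

∪ˡ : ∀ {ν} {p q : Subset ν} {x} → x ∈ p → x ∈ p ∪ q
∪ˡ = x∈p∪q⁺ ∘ inj₁

∪ʳ : ∀ {ν} {p q : Subset ν} {x} → x ∈ q → x ∈ p ∪ q
∪ʳ = x∈p∪q⁺ ∘ inj₂

∪-elim : ∀ {ν} {p q : Subset ν} {x} {A : Set} → (x ∈ p → A) → (x ∈ q → A) → x ∈ p ∪ q → A
∪-elim f g = [ f , g ] ∘ ∈∪-either

⊆-by-cases : ∀ {ν} {p q : Subset ν} r → (∀ {x} → x ∈ p → x ∈ r → x ∈ q) → (∀ {x} → x ∈ p → x ∉ r → x ∈ q) → p ⊆ q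
⊆-by-cases r f g {x} x∈ with x ∈? r
... | yes x∈r = f x∈ x∈r
... | no x∉r = g x∈ x∉r

p⊆q∪p─q : ∀ {ν} {p : Subset ν} q → p ⊆ q ∪ (p ─ q)
p⊆q∪p─q q = ⊆-by-cases q (λ _ → ∪ˡ) λ x∈ x∉ → ∪ʳ (x∈p∧x∉q⇒x∈p─q x∈ x∉)

sum-mono : ∀ {ν} {f g : Fin ν → ℕ} → (∀ i → f i ≤ g i) → sum f ≤ sum g
sum-mono {zero} _ = z≤n
sum-mono {suc ν} h = +-mono-≤ (h zero) (sum-mono (h ∘ suc))

-- Padding with zeros outside `X` turns every weight into a sum over all vertices, so that covering,
-- packing and monotonicity can be checked vertex by vertex.
value : (Fin ν → ℕ) → Subset ν → Fin ν → ℕ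
value f X v = if does (v ∈? X) then f v else 0

weight : (Fin ν → ℕ) → Subset ν → ℕ
weight f X = sum (value f X)

value-∈ : ∀ (f : Fin ν → ℕ) {X v} → v ∈ X → value f X v ≡ f v
value-∈ f {X} {v} v∈ rewrite dec-true (v ∈? X) v∈ = refl

value-∉ : ∀ (f : Fin ν → ℕ) {X v} → v ∉ X → value f X v ≡ 0
value-∉ f {X} {v} v∉ rewrite dec-false (v ∈? X) v∉ = refl

value-≤ : ∀ (f : Fin ν → ℕ) {X} {k} v → (v ∈ X → f v ≤ k) → value f X v ≤ k
value-≤ f {X} v h with v ∈? X
... | yes v∈ = h v∈
... | no _ = z≤n

weight-cover : ∀ (f : Fin ν → ℕ) {X Y Z} → X ⊆ Y ∪ Z → weight f X ≤ weight f Y + weight f Z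
weight-cover f {X} {Y} {Z} X⊆ = ≤-trans (sum-mono pointwise) (≤-reflexive (∑-distrib-+ (value f Y) (value f Z)))
  where
  pointwise : ∀ v → value f X v ≤ value f Y v + value f Z v
  pointwise v = value-≤ f v λ v∈X → case x∈p∪q⁻ Y Z (X⊆ v∈X) of λ where
    (inj₁ v∈Y) → ≤-trans (≤-reflexive (sym (value-∈ f v∈Y))) (m≤m+n _ _)
    (inj₂ v∈Z) → ≤-trans (≤-reflexive (sym (value-∈ f v∈Z))) (m≤n+m _ _)

weight-pack : ∀ (f : Fin ν → ℕ) {X Y Z} → Y ⊆ X → Z ⊆ X → (∀ {v} → v ∈ Y → v ∉ Z) →
              weight f Y + weight f Z ≤ weight f X
weight-pack f {X} {Y} {Z} Y⊆ Z⊆ disj =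
  ≤-trans (≤-reflexive (sym (∑-distrib-+ (value f Y) (value f Z)))) (sum-mono pointwise)
  where
  pointwise : ∀ v → value f Y v + value f Z v ≤ value f X v
  pointwise v with v ∈? Y | v ∈? Z
  ... | yes v∈Y | yes v∈Z = contradiction v∈Z (disj v∈Y)
  ... | yes v∈Y | no _ = ≤-reflexive (trans (+-identityʳ _) (sym (value-∈ f (Y⊆ v∈Y))))
  ... | no _ | yes v∈Z = ≤-reflexive (sym (value-∈ f (Z⊆ v∈Z)))
  ... | no _ | no _ = z≤n

weight-mono : ∀ {f g : Fin ν → ℕ} {X Y} → X ⊆ Y → (∀ {v} → v ∈ X → f v ≤ g v) → weight f X ≤ weight g Y
weight-mono {f = f} {g} X⊆Y h =
  sum-mono λ v → value-≤ f v λ v∈X → ≤-trans (h v∈X) (≤-reflexive (sym (value-∈ g (X⊆Y v∈X))))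

weight-monoˡ : ∀ (f : Fin ν → ℕ) {X Y} → X ⊆ Y → weight f X ≤ weight f Y
weight-monoˡ f X⊆Y = weight-mono X⊆Y (λ _ → ≤-refl)

weight-empty : ∀ (f : Fin ν → ℕ) {X} → (∀ {v} → v ∈ X → f v ≡ 0) → weight f X ≡ 0
weight-empty {ν} f {X} h = n≤0⇒n≡0 (≤-trans (weight-mono {g = λ _ → 0} {Y = X} (λ v∈ → v∈) (≤-reflexive ∘ h))
  (≤-reflexive (trans (Sum.sum-cong-≗ {ν} zeros) (Sum.sum-replicate-zero ν))))
  where
  zeros : ∀ v → value (λ _ → 0) X v ≡ 0
  zeros v with v ∈? X
  ... | yes _ = refl
  ... | no _ = refl

term≤sum : ∀ {ν} (t : Fin ν → ℕ) i → t i ≤ sum t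
term≤sum t zero = m≤m+n _ _
term≤sum t (suc i) = ≤-trans (term≤sum (t ∘ suc) i) (m≤n+m _ _)

∈⇒≤weight : ∀ (f : Fin ν → ℕ) {X v} → v ∈ X → f v ≤ weight f X
∈⇒≤weight f {X} {v} v∈ = ≤-trans (≤-reflexive (sym (value-∈ f v∈))) (term≤sum (value f X) v)

∣∣≡weight : ∀ (X : Subset ν) → ∣ X ∣ ≡ weight (λ _ → 1) X
∣∣≡weight [] = refl
∣∣≡weight (inside ∷ X) = cong suc (∣∣≡weight X)
∣∣≡weight (outside ∷ X) = ∣∣≡weight X

weight-const : ∀ (X : Subset ν) k → weight (λ _ → k) X ≡ ∣ X ∣ * k
weight-const [] k = refl
weight-const (inside ∷ X) k = cong (k +_) (weight-const X k)
weight-const (outside ∷ X) k = weight-const X k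

weight≤∣∣*k : ∀ {f : Fin ν → ℕ} {X k} → (∀ v → f v ≤ k) → weight f X ≤ ∣ X ∣ * k
weight≤∣∣*k {X = X} {k} h = ≤-trans (weight-mono (λ v∈ → v∈) (λ {v} _ → h v)) (≤-reflexive (weight-const X k))

∣∣≤weight : ∀ {f : Fin ν → ℕ} {X} → (∀ {v} → v ∈ X → 1 ≤ f v) → ∣ X ∣ ≤ weight f X
∣∣≤weight {X = X} h = ≤-trans (≤-reflexive (∣∣≡weight X)) (weight-mono (λ v∈ → v∈) h)

∣∣-cover : ∀ {X Y Z : Subset ν} → X ⊆ Y ∪ Z → ∣ X ∣ ≤ ∣ Y ∣ + ∣ Z ∣
∣∣-cover {X = X} {Y} {Z} X⊆ = subst₂ _≤_ (sym (∣∣≡weight X))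
  (sym (cong₂ _+_ (∣∣≡weight Y) (∣∣≡weight Z))) (weight-cover (λ _ → 1) X⊆)

⊆∧⊉⇒∣∣< : ∀ {X Y : Subset ν} → X ⊆ Y → ¬ Y ⊆ X → ∣ X ∣ < ∣ Y ∣
⊆∧⊉⇒∣∣< {X = X} {Y} X⊆Y ¬Y⊆X with nonempty? (Y ─ X)
... | yes (x , x∈) = p⊂q⇒∣p∣<∣q∣ (X⊆Y , x , x∈p─q⇒x∈p x∈ , x∈p─q⇒x∉q x∈)
... | no empty = ⊥-elim (¬Y⊆X Y⊆X)
  where
  Y⊆X : Y ⊆ X
  Y⊆X = ∪-elim id (λ x∈ → ⊥-elim (empty (_ , x∈))) ∘ p⊆q∪p─q X

-- Edge counts and elimination orders

module EdgeWeights {ν : ℕ} (a : Fin ν → Fin ν → ℕ) (a-sym : ∀ u v → a u v ≡ a v u) where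

  e : Subset ν → Subset ν → ℕ
  e X Y = weight (λ u → weight (a u) Y) X

  e-sym : ∀ X Y → e X Y ≡ e Y X
  e-sym X Y = begin
    sum (value (λ u → sum (value (a u) Y)) X)              ≡⟨ Sum.sum-cong-≗ expand ⟩
    sum (λ u → sum (λ v → value (λ u → value (a u) Y v) X u)) ≡⟨ ∑-comm {ν} {ν} _ ⟩
    sum (λ v → sum (λ u → value (λ u → value (a u) Y v) X u)) ≡⟨ Sum.sum-cong-≗ collect ⟩
    sum (value (λ v → sum (value (a v) X)) Y)              ∎
    where
    open ≡-Reasoning
    expand : ∀ u → value (λ u → sum (value (a u) Y)) X u ≡ sum (λ v → value (λ u → value (a u) Y v) X u)
    expand u with u ∈? X
    ... | yes _ = refl
    ... | no _ = sym (Sum.sum-replicate-zero ν)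
    swap : ∀ u v → v ∈ Y → value (λ u → value (a u) Y v) X u ≡ value (a v) X u
    swap u v v∈Y with u ∈? X
    ... | yes _ = trans (value-∈ (a u) v∈Y) (a-sym u v)
    ... | no _ = refl
    vanish : ∀ u v → v ∉ Y → value (λ u → value (a u) Y v) X u ≡ 0
    vanish u v v∉Y with u ∈? X
    ... | yes _ = value-∉ (a u) v∉Y
    ... | no _ = refl
    collect : ∀ v → sum (λ u → value (λ u → value (a u) Y v) X u) ≡ value (λ v → sum (value (a v) X)) Y v
    collect v = case v ∈? Y of λ where
      (yes v∈Y) → trans (Sum.sum-cong-≗ λ u → swap u v v∈Y) (sym (value-∈ (λ v → sum (value (a v) X)) v∈Y))
      (no v∉Y) → trans (trans (Sum.sum-cong-≗ λ u → vanish u v v∉Y) (Sum.sum-replicate-zero ν))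
                   (sym (value-∉ (λ v → sum (value (a v) X)) v∉Y))

  e-coverˡ : ∀ {X Y Z} W → X ⊆ Y ∪ Z → e X W ≤ e Y W + e Z W
  e-coverˡ W = weight-cover (λ u → weight (a u) W)

  e-coverʳ : ∀ {X Y Z} W → X ⊆ Y ∪ Z → e W X ≤ e W Y + e W Z
  e-coverʳ {X} {Y} {Z} W X⊆ = subst₂ _≤_ (e-sym X W) (cong₂ _+_ (e-sym Y W) (e-sym Z W)) (e-coverˡ W X⊆)

  e-packˡ : ∀ {X Y Z} W → Y ⊆ X → Z ⊆ X → (∀ {v} → v ∈ Y → v ∉ Z) → e Y W + e Z W ≤ e X W
  e-packˡ W = weight-pack (λ u → weight (a u) W)

  e-packʳ : ∀ {X Y Z} W → Y ⊆ X → Z ⊆ X → (∀ {v} → v ∈ Y → v ∉ Z) → e W Y + e W Z ≤ e W X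
  e-packʳ {X} {Y} {Z} W Y⊆ Z⊆ disj =
    subst₂ _≤_ (cong₂ _+_ (e-sym Y W) (e-sym Z W)) (e-sym X W) (e-packˡ W Y⊆ Z⊆ disj)

  e-mono : ∀ {X X′ Y Y′} → X ⊆ X′ → Y ⊆ Y′ → e X Y ≤ e X′ Y′
  e-mono X⊆ Y⊆ = weight-mono X⊆ λ {u} _ → weight-monoˡ (a u) Y⊆

  NoEdge : Subset ν → Subset ν → Set
  NoEdge X Y = ∀ {u v} → u ∈ X → v ∈ Y → a u v ≡ 0

  e-NoEdge : ∀ {X Y} → NoEdge X Y → e X Y ≡ 0
  e-NoEdge ne = weight-empty _ λ {u} u∈ → weight-empty (a u) λ v∈ → ne u∈ v∈

  NoEdge? : ∀ X Y → Dec (NoEdge X Y)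
  NoEdge? X Y with all? (λ u → all? λ v → (u ∈? X) →-dec ((v ∈? Y) →-dec (a u v ℕ.≟ 0)))
  ... | yes h = yes λ {u} {v} → h u v
  ... | no ¬h = no λ h → ¬h λ u v → h

  neighbour? : ∀ A C v → Dec (v ∈ A × v ∉ C × ∃ λ u → u ∈ C × a u v ≢ 0)
  neighbour? A C v = (v ∈? A) ×-dec (¬? (v ∈? C) ×-dec any? λ u → (u ∈? C) ×-dec ¬? (a u v ℕ.≟ 0))

  N : Subset ν → Subset ν → Subset ν
  N A C = ⟪ neighbour? A C ⟫

  -- Good k A C: the vertices of C can be eliminated from G[A] with bags of size at most k, where the
  -- bag of v consists of v and the neighbours in A of the region C from which v is removed. Thus
  -- Good k A A says that G[A] has treewidth below k, in a form that is decidable by recursion on ∣ C ∣.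
  data Good (k : ℕ) (A : Subset ν) : Subset ν → Set where
    done  : ∀ {C} → Empty C → Good k A C
    add   : ∀ {C} v → v ∈ C → ∣ N A C ∪ ⁅ v ⁆ ∣ ≤ k → Good k A (C - v) → Good k A C
    split : ∀ {C} D → D ⊆ C → ∣ D ∣ < ∣ C ∣ → ∣ C ─ D ∣ < ∣ C ∣ → NoEdge D (C ─ D) →
            Good k A D → Good k A (C ─ D) → Good k A C

  -- Every premise of `Good` concerns a smaller region, in `split` because the constructor demands
  -- it, so recursion on a bound for `∣ C ∣` with exhaustive search decides. All later distinctions
  -- between small and large sets rest on this.
  good? : ∀ k A C → Dec (Good k A C)
  good? k A C = go ∣ C ∣ C ≤-refl
    where
    go : ∀ f C → ∣ C ∣ ≤ f → Dec (Good k A C)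
    Add : Subset ν → Fin ν → Set
    Add C v = v ∈ C × ∣ N A C ∪ ⁅ v ⁆ ∣ ≤ k × Good k A (C - v)
    Split : Subset ν → Subset ν → Set
    Split C D = D ⊆ C × ∣ D ∣ < ∣ C ∣ × ∣ C ─ D ∣ < ∣ C ∣ × NoEdge D (C ─ D) × Good k A D × Good k A (C ─ D)
    go zero C ∣C∣≤0 = yes (done λ (x , x∈) → n≮0 (<-≤-trans (x∈p⇒∣p-x∣<∣p∣ x∈) ∣C∣≤0))
    go (suc f) C ∣C∣≤ with nonempty? C | any? add? | anySubset? split?
      where
      smaller : ∀ {D} → ∣ D ∣ < ∣ C ∣ → Dec (Good k A D)
      smaller lt = go f _ (≤-pred (≤-trans lt ∣C∣≤))
      add? : ∀ v → Dec (Add C v)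
      add? v with v ∈? C
      ... | no v∉ = no (v∉ ∘ proj₁)
      ... | yes v∈ with ∣ N A C ∪ ⁅ v ⁆ ∣ ≤? k | smaller (x∈p⇒∣p-x∣<∣p∣ v∈)
      ...   | yes le | yes g = yes (v∈ , le , g)
      ...   | no gt | _ = no (gt ∘ proj₁ ∘ proj₂)
      ...   | yes _ | no ¬g = no (¬g ∘ proj₂ ∘ proj₂)
      split? : ∀ D → Dec (Split C D)
      split? D with ∣ D ∣ <? ∣ C ∣ | ∣ C ─ D ∣ <? ∣ C ∣
      ... | no ge | _ = no (ge ∘ proj₁ ∘ proj₂)
      ... | yes _ | no ge = no (ge ∘ proj₁ ∘ proj₂ ∘ proj₂)
      ... | yes lt₁ | yes lt₂ with D ⊆? C | NoEdge? D (C ─ D) | smaller lt₁ | smaller lt₂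
      ...   | yes D⊆ | yes ne | yes g₁ | yes g₂ = yes (D⊆ , lt₁ , lt₂ , ne , g₁ , g₂)
      ...   | no ¬D⊆ | _ | _ | _ = no λ (D⊆ , _) → ¬D⊆ D⊆
      ...   | yes _ | no ¬ne | _ | _ = no λ (_ , _ , _ , ne , _) → ¬ne ne
      ...   | yes _ | yes _ | no ¬g | _ = no λ (_ , _ , _ , _ , g , _) → ¬g g
      ...   | yes _ | yes _ | yes _ | no ¬g = no λ (_ , _ , _ , _ , _ , g) → ¬g g
    ... | no empty | _ | _ = yes (done empty)
    ... | yes _ | yes (v , v∈ , le , g) | _ = yes (add v v∈ le g)
    ... | yes _ | no _ | yes (D , D⊆ , lt₁ , lt₂ , ne , g₁ , g₂) = yes (split D D⊆ lt₁ lt₂ ne g₁ g₂)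
    ... | yes nonempty | no ¬add | no ¬split = no λ where
      (done empty) → empty nonempty
      (add v v∈ le g) → ¬add (v , v∈ , le , g)
      (split D D⊆ lt₁ lt₂ ne g₁ g₂) → ¬split (D , D⊆ , lt₁ , lt₂ , ne , g₁ , g₂)

  N⁺ : ∀ {A C u x} → u ∈ C → x ∈ A → x ∉ C → a u x ≢ 0 → x ∈ N A C
  N⁺ {A} {C} u∈ x∈ x∉ adj = ∈⟪⟫⁺ (neighbour? A C) (x∈ , x∉ , _ , u∈ , adj)

  N⁻ : ∀ {A C x} → x ∈ N A C → x ∈ A × x ∉ C × ∃ λ u → u ∈ C × a u x ≢ 0
  N⁻ {A} {C} = ∈⟪⟫⁻ (neighbour? A C)

  -- The boundary left after eliminating `v` thus fits into the bag of `v`: the next bag can hang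
  -- below it, and its size bounds the boundary.
  N-delete : ∀ {A C} v → N A (C - v) ⊆ N A C ∪ ⁅ v ⁆
  N-delete v {x} x∈ with x ≟ v | N⁻ x∈
  ... | yes refl | _ = ∪ʳ (x∈⁅x⁆ x)
  ... | no x≢v | x∈A , x∉ , u , u∈ , adj =
    ∪ˡ (N⁺ (x∈p─q⇒x∈p u∈) x∈A (λ x∈C → x∉ (x∈p∧x≢y⇒x∈p-y x∈C x≢v)) adj)

  N-part : ∀ {A C D} → D ⊆ C → NoEdge D (C ─ D) → N A D ⊆ N A C
  N-part D⊆ ne x∈ with N⁻ x∈
  ... | x∈A , x∉ , u , u∈ , adj = N⁺ (D⊆ u∈) x∈A (λ x∈C → adj (ne u∈ (x∈p∧x∉q⇒x∈p─q x∈C x∉))) adj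

  N-rest : ∀ {A C D} → NoEdge D (C ─ D) → N A (C ─ D) ⊆ N A C
  N-rest {D = D} ne {x} x∈ with x ∈? D | N⁻ x∈
  ... | yes x∈D | _ , _ , u , u∈ , adj = ⊥-elim (adj (trans (a-sym u x) (ne x∈D u∈)))
  ... | no x∉D | x∈A , x∉ , u , u∈ , adj =
    N⁺ (x∈p─q⇒x∈p u∈) x∈A (λ x∈C → x∉ (x∈p∧x∉q⇒x∈p─q x∈C x∉D)) adj

  NoEdge-sym : ∀ {X Y} → NoEdge X Y → NoEdge Y X
  NoEdge-sym ne u∈ v∈ = trans (a-sym _ _) (ne v∈ u∈)

  -- Replays the elimination of `C`, skipping vertices outside `C′`. By the last hypothesis a bag
  -- can gain only vertices of `X`. With `X = ⊥` this changes region and ambient set at no cost.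
  good-restrict : ∀ {k A C A′ C′ j} X → Good k A C → C ⊆ A → C′ ⊆ C → ∣ X ∣ ≤ j →
                  (∀ {u x} → u ∈ C′ → x ∈ A′ → x ∉ C′ → a u x ≢ 0 → (x ∈ A × x ∉ C) ⊎ x ∈ X) →
                  Good (k + j) A′ C′
  good-restrict X (done empty) C⊆ C′⊆ ∣X∣≤ h = done λ (x , x∈) → empty (x , C′⊆ x∈)
  good-restrict {k} {A} {C} {A′} {C′} {j} X (add v v∈ le g) C⊆ C′⊆ ∣X∣≤ h with v ∈? C′
  ... | no v∉ = good-restrict X g (C⊆ ∘ x∈p─q⇒x∈p)
          (λ x∈ → x∈p∧x≢y⇒x∈p-y (C′⊆ x∈) λ { refl → v∉ x∈ }) ∣X∣≤
          λ u∈ x∈ x∉ adj → case h u∈ x∈ x∉ adj of λ where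
            (inj₁ (x∈A , x∉C)) → inj₁ (x∈A , x∉C ∘ x∈p─q⇒x∈p)
            (inj₂ x∈X) → inj₂ x∈X
  ... | yes v∈C′ = add v v∈C′ (≤-trans (∣∣-cover boundary) (+-mono-≤ le ∣X∣≤))
          (good-restrict X g (C⊆ ∘ x∈p─q⇒x∈p)
            (λ x∈ → x∈p∧x≢y⇒x∈p-y (C′⊆ (x∈p─q⇒x∈p x∈)) (x∈p-y⇒x≢y x∈)) ∣X∣≤ h′)
    where
    boundary : N A′ C′ ∪ ⁅ v ⁆ ⊆ (N A C ∪ ⁅ v ⁆) ∪ X
    boundary x∈ with ∈∪-either x∈
    ... | inj₂ x≡v = ∪ˡ (∪ʳ x≡v)
    ... | inj₁ x∈N with N⁻ x∈N
    ...   | x∈A′ , x∉C′ , u , u∈C′ , adj with h u∈C′ x∈A′ x∉C′ adj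
    ...     | inj₁ (x∈A , x∉C) = ∪ˡ (∪ˡ (N⁺ (C′⊆ u∈C′) x∈A x∉C adj))
    ...     | inj₂ x∈X = ∪ʳ x∈X
    h′ : ∀ {u x} → u ∈ C′ - v → x ∈ A′ → x ∉ C′ - v → a u x ≢ 0 → (x ∈ A × x ∉ C - v) ⊎ x ∈ X
    h′ {u} {x} u∈ x∈ x∉ adj with x ≟ v
    -- The vertex just eliminated becomes an outside neighbour; it belongs to `A` because `C ⊆ A`.
    ... | yes refl = inj₁ (C⊆ v∈ , λ x∈C-x → x∈p-y⇒x≢y x∈C-x refl)
    ... | no x≢v with h (x∈p─q⇒x∈p u∈) x∈ (λ x∈C′ → x∉ (x∈p∧x≢y⇒x∈p-y x∈C′ x≢v)) adj
    ...   | inj₁ (x∈A , x∉C) = inj₁ (x∈A , x∉C ∘ x∈p─q⇒x∈p)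
    ...   | inj₂ x∈X = inj₂ x∈X
  good-restrict {k} {A} {C} {A′} {C′} {j} X (split D D⊆ _ _ ne g₁ g₂) C⊆ C′⊆ ∣X∣≤ h
    with C′ ⊆? D | C′ ⊆? (C ─ D)
  -- If `C′` lies in one part, a `split` of it would not be strict; the elimination of that part
  -- alone is followed.
  ... | yes C′⊆D | _ = good-restrict X g₁ (C⊆ ∘ D⊆) C′⊆D ∣X∣≤ λ u∈ x∈ x∉ adj → case h u∈ x∈ x∉ adj of λ where
            (inj₁ (x∈A , x∉C)) → inj₁ (x∈A , x∉C ∘ D⊆)
            (inj₂ x∈X) → inj₂ x∈X
  ... | no _ | yes C′⊆C─D = good-restrict X g₂ (C⊆ ∘ x∈p─q⇒x∈p) C′⊆C─D ∣X∣≤ λ u∈ x∈ x∉ adj →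
          case h u∈ x∈ x∉ adj of λ where
            (inj₁ (x∈A , x∉C)) → inj₁ (x∈A , x∉C ∘ x∈p─q⇒x∈p)
            (inj₂ x∈X) → inj₂ x∈X
  ... | no ¬C′⊆D | no ¬C′⊆C─D = split (C′ ∩ D) left⊆
          (⊆∧⊉⇒∣∣< left⊆ λ ⊇ → ¬C′⊆D λ x∈ → proj₂ (x∈p∩q⁻ C′ D (⊇ x∈)))
          (⊆∧⊉⇒∣∣< x∈p─q⇒x∈p λ ⊇ → ¬C′⊆C─D λ x∈ → right⊆ (⊇ x∈))
          (λ u∈ v∈ → ne (proj₂ (x∈p∩q⁻ C′ D u∈)) (right⊆ v∈))
          (good-restrict X g₁ (C⊆ ∘ D⊆) (proj₂ ∘ x∈p∩q⁻ C′ D) ∣X∣≤ h₁)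
          (good-restrict X g₂ (C⊆ ∘ x∈p─q⇒x∈p) right⊆ ∣X∣≤ h₂)
    where
    left⊆ : C′ ∩ D ⊆ C′
    left⊆ = p∩q⊆p C′ D
    right⊆ : C′ ─ (C′ ∩ D) ⊆ C ─ D
    right⊆ x∈ = x∈p∧x∉q⇒x∈p─q (C′⊆ (x∈p─q⇒x∈p x∈)) λ x∈D → x∈p─q⇒x∉q x∈ (x∈p∩q⁺ (x∈p─q⇒x∈p x∈ , x∈D))
    h₁ : ∀ {u x} → u ∈ C′ ∩ D → x ∈ A′ → x ∉ C′ ∩ D → a u x ≢ 0 → (x ∈ A × x ∉ D) ⊎ x ∈ X
    h₁ {u} {x} u∈ x∈ x∉ adj with x ∈? C′
    ... | yes x∈C′ = ⊥-elim (adj (ne (p∩q⊆q C′ D u∈) (right⊆ (x∈p∧x∉q⇒x∈p─q x∈C′ x∉))))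
    ... | no x∉C′ with h (left⊆ u∈) x∈ x∉C′ adj
    ...   | inj₁ (x∈A , x∉C) = inj₁ (x∈A , x∉C ∘ D⊆)
    ...   | inj₂ x∈X = inj₂ x∈X
    h₂ : ∀ {u x} → u ∈ C′ ─ (C′ ∩ D) → x ∈ A′ → x ∉ C′ ─ (C′ ∩ D) → a u x ≢ 0 → (x ∈ A × x ∉ C ─ D) ⊎ x ∈ X
    h₂ {u} {x} u∈ x∈ x∉ adj with x ∈? C′
    ... | no x∉C′ = case h (x∈p─q⇒x∈p u∈) x∈ x∉C′ adj of λ where
            (inj₁ (x∈A , x∉C)) → inj₁ (x∈A , x∉C ∘ x∈p─q⇒x∈p)
            (inj₂ x∈X) → inj₂ x∈X
    ... | yes x∈C′ with x ∈? C′ ∩ D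
    ...   | yes x∈D = ⊥-elim (adj (trans (a-sym _ _) (ne (p∩q⊆q C′ D x∈D) (right⊆ u∈))))
    ...   | no x∉D = ⊥-elim (x∉ (x∈p∧x∉q⇒x∈p─q x∈C′ x∉D))

  -- `split` wants two proper parts. If one part is all of `C`, its own elimination serves.
  good-glue : ∀ {k A C D₁ D₂} → Good k A D₁ → Good k A D₂ → D₁ ⊆ C → D₂ ⊆ C → C ⊆ D₁ ∪ D₂ →
              (∀ {v} → v ∈ D₁ → v ∉ D₂) → NoEdge D₁ D₂ → Good k A C
  good-glue {k} {A} {C} {D₁} {D₂} g₁ g₂ D₁⊆ D₂⊆ C⊆ disj ne with C ⊆? D₁ | C ⊆? D₂
  ... | yes C⊆D₁ | _ = subst (Good k A) (⊆-antisym D₁⊆ C⊆D₁) g₁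
  ... | no _ | yes C⊆D₂ = subst (Good k A) (⊆-antisym D₂⊆ C⊆D₂) g₂
  ... | no ¬C⊆D₁ | no ¬C⊆D₂ =
    split D₁ D₁⊆ (⊆∧⊉⇒∣∣< D₁⊆ ¬C⊆D₁) (subst (λ D → ∣ D ∣ < ∣ C ∣) D₂≡ (⊆∧⊉⇒∣∣< D₂⊆ ¬C⊆D₂))
      (subst (NoEdge D₁) D₂≡ ne) g₁ (subst (Good k A) D₂≡ g₂)
    where
    D₂≡ : D₂ ≡ C ─ D₁
    D₂≡ = ⊆-antisym (λ x∈ → x∈p∧x∉q⇒x∈p─q (D₂⊆ x∈) λ x∈D₁ → disj x∈D₁ x∈)
      λ x∈ → case ∈∪-either (C⊆ (x∈p─q⇒x∈p x∈)) of λ where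
        (inj₁ x∈D₁) → ⊥-elim (x∈p─q⇒x∉q x∈ x∈D₁)
        (inj₂ x∈D₂) → x∈D₂

  -- All of C ─ D can be eliminated within the single bag Z.
  good-fill : ∀ {k A C D} Z → Good k A D → D ⊆ C → C ─ D ⊆ Z → ∣ Z ∣ ≤ k →
              (∀ {E} → D ⊆ E → E ⊆ C → N A E ⊆ Z) → Good k A C
  good-fill {k} {A} {C} {D} Z g D⊆C rest⊆Z ∣Z∣≤k h = go ∣ C ∣ C ≤-refl D⊆C id
    where
    go : ∀ f E → ∣ E ∣ ≤ f → D ⊆ E → E ⊆ C → Good k A E
    go f E ∣E∣≤f D⊆E E⊆C with nonempty? (E ─ D)
    ... | no empty = subst (Good k A) (⊆-antisym D⊆E E⊆D) g
      where
      E⊆D : E ⊆ D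
      E⊆D = ∪-elim id (λ x∈ → ⊥-elim (empty (_ , x∈))) ∘ p⊆q∪p─q D
    go zero E ∣E∣≤0 D⊆E E⊆C | yes (v , v∈) =
      ⊥-elim (n≮0 (<-≤-trans (x∈p⇒∣p-x∣<∣p∣ (x∈p─q⇒x∈p v∈)) ∣E∣≤0))
    go (suc f) E ∣E∣≤f D⊆E E⊆C | yes (v , v∈) =
      add v (x∈p─q⇒x∈p v∈) (≤-trans (p⊆q⇒∣p∣≤∣q∣ bag⊆Z) ∣Z∣≤k)
        (go f (E - v) (≤-pred (≤-trans (x∈p⇒∣p-x∣<∣p∣ (x∈p─q⇒x∈p v∈)) ∣E∣≤f))
          (λ x∈D → x∈p∧x≢y⇒x∈p-y (D⊆E x∈D) λ { refl → x∈p─q⇒x∉q v∈ x∈D }) (E⊆C ∘ x∈p─q⇒x∈p))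
      where
      bag⊆Z : N A E ∪ ⁅ v ⁆ ⊆ Z
      bag⊆Z x∈ with ∈∪-either x∈
      ... | inj₁ x∈N = h D⊆E E⊆C x∈N
      ... | inj₂ x∈v rewrite x∈⁅y⁆⇒x≡y v x∈v =
        rest⊆Z (x∈p∧x∉q⇒x∈p─q (E⊆C (x∈p─q⇒x∈p v∈)) (x∈p─q⇒x∉q v∈))

  Small : ℕ → Subset ν → Set
  Small k A = Good k A A

  small-⊆ : ∀ {k A B} → Small k A → B ⊆ A → Small k B
  small-⊆ {k} {B = B} g B⊆A = subst (λ k → Small k B) (+-identityʳ k)
    (good-restrict ⊥ g id B⊆A (≤-reflexive (∣⊥∣≡0 ν)) λ _ x∈ x∉ _ → ⊥-elim (x∉ x∈))

  -- The vertices of `X` go first, within the single bag `X`; every later bag is an old one enlarged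
  -- by at most `X`.
  small-∪ : ∀ {k A B} X → Small k A → B ⊆ A ∪ X → Small (k + ∣ X ∣) B
  small-∪ {k} {A} {B} X g B⊆ = good-fill X core x∈p─q⇒x∈p (λ x∈ → rest⊆X x∈) (m≤n+m ∣ X ∣ k)
      λ D⊆E E⊆B x∈N → let x∈B , x∉E , _ = N⁻ x∈N in rest⊆X (x∈p∧x∉q⇒x∈p─q x∈B (x∉E ∘ D⊆E))
    where
    rest⊆X : B ─ (B ─ X) ⊆ X
    rest⊆X {x} x∈ with x ∈? X
    ... | yes x∈X = x∈X
    ... | no x∉X = ⊥-elim (x∈p─q⇒x∉q x∈ (x∈p∧x∉q⇒x∈p─q (x∈p─q⇒x∈p x∈) x∉X))
    core : Good (k + ∣ X ∣) B (B ─ X)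
    core = good-restrict X g id
      (λ x∈ → case ∈∪-either (B⊆ (x∈p─q⇒x∈p x∈)) of λ where
        (inj₁ x∈A) → x∈A
        (inj₂ x∈X) → ⊥-elim (x∈p─q⇒x∉q x∈ x∈X))
      ≤-refl λ _ x∈ x∉ _ → inj₂ (rest⊆X (x∈p∧x∉q⇒x∈p─q x∈ x∉))

  small-⊔ : ∀ {k P Q C} → Small k P → Small k Q → P ⊆ C → Q ⊆ C → C ⊆ P ∪ Q →
            (∀ {v} → v ∈ P → v ∉ Q) → NoEdge P Q → Small k C
  small-⊔ {k} {P} {Q} {C} gP gQ P⊆ Q⊆ C⊆ disj ne =
    good-glue (restrict gP (λ x∈ x∉ → [ ⊥-elim ∘ x∉ , id ] (∈∪-either (C⊆ x∈))) ne)
      (restrict gQ (λ x∈ x∉ → [ id , ⊥-elim ∘ x∉ ] (∈∪-either (C⊆ x∈))) (NoEdge-sym ne)) P⊆ Q⊆ C⊆ disj ne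
    where
    restrict : ∀ {P Q} → Small k P → (∀ {x} → x ∈ C → x ∉ P → x ∈ Q) → NoEdge P Q → Good k C P
    restrict {P} g other ne = subst (λ k → Good k C P) (+-identityʳ k)
      (good-restrict ⊥ g id id (≤-reflexive (∣⊥∣≡0 ν)) λ u∈ x∈ x∉ adj → ⊥-elim (adj (ne u∈ (other x∈ x∉))))

  good-k-mono : ∀ {k k′ A C} → Good k A C → k ≤ k′ → Good k′ A C
  good-k-mono (done empty) le = done empty
  good-k-mono (add v v∈ b g) le = add v v∈ (≤-trans b le) (good-k-mono g le)
  good-k-mono (split D D⊆ l₁ l₂ ne g₁ g₂) le = split D D⊆ l₁ l₂ ne (good-k-mono g₁ le) (good-k-mono g₂ le)

-- Multigraphs and tree decompositions

δ : Fin ν → Fin ν → ℕ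
δ x u = if does (x ≟ u) then 1 else 0

multiplicity : List (Fin ν × Fin ν) → Fin ν → Fin ν → ℕ
multiplicity [] u v = 0
multiplicity ((x , y) ∷ es) u v = δ x u * δ y v + δ x v * δ y u + multiplicity es u v

multiplicity-sym : ∀ (es : List (Fin ν × Fin ν)) u v → multiplicity es u v ≡ multiplicity es v u
multiplicity-sym [] u v = refl
multiplicity-sym ((x , y) ∷ es) u v = cong₂ _+_ (+-comm (δ x u * δ y v) _) (multiplicity-sym es u v)

δ≢0⇒≡ : ∀ {x u : Fin ν} → δ x u ≢ 0 → x ≡ u
δ≢0⇒≡ {x = x} {u} ≢0 with x ≟ u
... | yes x≡u = x≡u
... | no _ = ⊥-elim (≢0 refl)

δ*δ≢0 : ∀ (x y u v : Fin ν) → δ x u * δ y v ≢ 0 → x ≡ u × y ≡ v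
δ*δ≢0 x y u v ≢0 =
  δ≢0⇒≡ (λ eq → ≢0 (cong (_* _) eq)) , δ≢0⇒≡ λ eq → ≢0 (trans (cong (δ x u *_) eq) (*-zeroʳ (δ x u)))

+≢0 : ∀ m {k} → m + k ≢ 0 → m ≢ 0 ⊎ k ≢ 0
+≢0 zero ≢0 = inj₂ ≢0
+≢0 (suc m) _ = inj₁ λ ()

multiplicity≢0 : ∀ {P : Fin ν × Fin ν → Set} {es u v} → All P es → multiplicity es u v ≢ 0 → P (u , v) ⊎ P (v , u)
multiplicity≢0 [] ≢0 = ⊥-elim (≢0 refl)
multiplicity≢0 {es = (x , y) ∷ es} {u} {v} (p ∷ ps) ≢0 with +≢0 (δ x u * δ y v + δ x v * δ y u) ≢0
... | inj₂ rest = multiplicity≢0 ps rest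
... | inj₁ this with +≢0 (δ x u * δ y v) this
...   | inj₁ h with refl , refl ← δ*δ≢0 x y u v h = inj₁ p
...   | inj₂ h with refl , refl ← δ*δ≢0 x y v u h = inj₂ p

δ-refl : ∀ (x : Fin ν) → δ x x ≡ 1
δ-refl x rewrite dec-true (x ≟ x) refl = refl

∈⇒multiplicity≢0 : ∀ {es : List (Fin ν × Fin ν)} {u v} → (u , v) ∈ˡ es → multiplicity es u v ≢ 0
∈⇒multiplicity≢0 {es = _ ∷ es} {u} {v} (here refl) rewrite δ-refl u | δ-refl v = λ ()
∈⇒multiplicity≢0 {es = (x , y) ∷ es} {u} {v} (there ∈es) eq =
  ∈⇒multiplicity≢0 ∈es (m+n≡0⇒n≡0 (δ x u * δ y v + δ x v * δ y u) eq)

sum-δ : ∀ (y : Fin ν) → sum (δ y) ≡ 1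
sum-δ {suc ν} zero = cong suc (Sum.sum-replicate-zero ν)
sum-δ {suc ν} (suc y) = trans (Sum.sum-cong-≗ shift) (sum-δ y)
  where
  shift : ∀ i → δ (suc y) (suc i) ≡ δ y i
  shift i with y ≟ i
  ... | yes _ = refl
  ... | no _ = refl

-- Each edge at `u` adds one to both sides. A loop would add two on the left and one on the right,
-- so `noLoops` enters here.
sum-multiplicity≤degree : (G : Graph) (u : Fin (n G)) → sum (multiplicity (edges G) u) ≤ degree G u
sum-multiplicity≤degree G u = go (edges G) (noLoops G)
  where
  P? : ∀ e → Dec (proj₁ e ≡ u ⊎ proj₂ e ≡ u)
  P? e = (proj₁ e ≟ u) ⊎-dec (proj₂ e ≟ u)
  go : ∀ es → All (λ e → proj₁ e ≢ proj₂ e) es → sum (multiplicity es u) ≤ length (filter P? es)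
  go [] [] = ≤-reflexive (Sum.sum-replicate-zero (n G))
  go ((x , y) ∷ es) (x≢y ∷ nl) = begin
    sum (λ v → δ x u * δ y v + δ x v * δ y u + multiplicity es u v)
      ≡⟨ ∑-distrib-+ (λ v → δ x u * δ y v + δ x v * δ y u) (multiplicity es u) ⟩
    sum (λ v → δ x u * δ y v + δ x v * δ y u) + sum (multiplicity es u)
      ≡⟨ cong (_+ sum (multiplicity es u)) (∑-distrib-+ (λ v → δ x u * δ y v) (λ v → δ x v * δ y u)) ⟩
    sum (λ v → δ x u * δ y v) + sum (λ v → δ x v * δ y u) + sum (multiplicity es u)
      ≡⟨ cong (_+ sum (multiplicity es u)) (cong₂ _+_
           (trans (sym (Sum.*-distribˡ-sum (δ x u) (δ y))) (trans (cong (δ x u *_) (sum-δ y)) (*-identityʳ _)))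
           (trans (sym (Sum.*-distribʳ-sum (δ y u) (δ x))) (trans (cong (_* δ y u) (sum-δ x)) (*-identityˡ _)))) ⟩
    δ x u + δ y u + sum (multiplicity es u)
      ≤⟨ +-monoʳ-≤ (δ x u + δ y u) (go es nl) ⟩
    δ x u + δ y u + length (filter P? es)
      ≤⟨ count ⟩
    length (filter P? ((x , y) ∷ es)) ∎
    where
    open ≤-Reasoning
    count : δ x u + δ y u + length (filter P? es) ≤ length (filter P? ((x , y) ∷ es))
    count with x ≟ u | y ≟ u
    ... | yes refl | yes refl = ⊥-elim (x≢y refl)
    ... | yes _ | no _ = ≤-refl
    ... | no _ | yes _ = ≤-refl
    ... | no _ | no _ = ≤-refl

-- From tree decompositions to elimination orders

data Below (T : Tree) (c : Fin (suc (m T))) : Fin (suc (m T)) → Set where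
  here  : Below T c c
  child : ∀ i → Below T c (par T i) → Below T c (suc i)

below? : ∀ T c t → Dec (Below T c t)
below? T c t = go (toℕ t) t ≤-refl
  where
  go : ∀ f t → toℕ t ≤ f → Dec (Below T c t)
  go f t t≤f with t ≟ c
  ... | yes refl = yes here
  go f zero t≤f | no t≢c = no λ { here → t≢c refl }
  go (suc f) (suc i) (s≤s i≤f) | no t≢c with go f (par T i) (≤-trans (parLt T i) i≤f)
  ... | yes b = yes (child i b)
  ... | no ¬b = no λ { here → t≢c refl ; (child .i b) → ¬b b }

below⇒≤ : ∀ {T c t} → Below T c t → toℕ c ≤ toℕ t
below⇒≤ here = ≤-refl
below⇒≤ {T} (child i b) = ≤-trans (below⇒≤ b) (m≤n⇒m≤1+n (parLt T i))

-- A walk can leave the subtree below c only through c and then its parent, which has a smaller index.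
leave-subtree : ∀ {T S c d t} → Below T c d → Reach T S d t → Below T c t ⊎ (S c × ∃ λ p → toℕ p < toℕ c × S p)
leave-subtree b (Reach.here _) = inj₁ b
leave-subtree {T} {S} {c} b (step r adj s) with leave-subtree b r
... | inj₂ out = inj₂ out
... | inj₁ b′ with adj
...   | down i = inj₁ (child i b′)
...   | up i with b′
...     | here = inj₂ (last r , _ , s≤s (parLt T i) , s)
  where
  last : ∀ {d t} → Reach T S d t → S t
  last (Reach.here s) = s
  last (step _ _ s) = s
...     | child .i b″ = inj₁ b″

module FromTD (G : Graph) (A : Subset (n G)) (D : TreeDecomposition G A) (k : ℕ)
              (bag≤k : ∀ t → ∣ bag D t ∣ ≤ k) where
  private
    a = multiplicity (edges G)
    T = tree D
  open EdgeWeights a (multiplicity-sym (edges G))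

  common-bag : ∀ {u v} → u ∈ A → v ∈ A → a u v ≢ 0 → ∃ λ t → u ∈ bag D t × v ∈ bag D t
  common-bag u∈ v∈ adj with multiplicity≢0 (edgeCov D) adj
  ... | inj₁ cov = cov u∈ v∈
  ... | inj₂ cov = let t , v∈t , u∈t = cov v∈ u∈ in t , u∈t , v∈t

  Early : ℕ → Fin (n G) → Set
  Early c v = ∃ λ t → toℕ t < c × v ∈ bag D t

  early? : ∀ c v → Dec (Early c v)
  early? c v = any? λ t → (toℕ t <? c) ×-dec (v ∈? bag D t)

  Late : ℕ → Subset (n G)
  Late c = A ─ ⟪ early? c ⟫

  late⁺ : ∀ {c v} → v ∈ A → ¬ Early c v → v ∈ Late c
  late⁺ {c} v∈ ¬e = x∈p∧x∉q⇒x∈p─q v∈ (¬e ∘ ∈⟪⟫⁻ (early? c))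

  late⁻ : ∀ {c v} → v ∈ Late c → ¬ Early c v
  late⁻ {c} v∈ e = x∈p─q⇒x∉q v∈ (∈⟪⟫⁺ (early? c) e)

  -- Induction over the nodes from the last to the root: Late c consists of the vertices in no bag of
  -- index below c, and is separated by bag c into the part H hanging below c and the rest.
  module Step (c : Fin (suc (m T))) (gLate : Good k A (Late (suc (toℕ c)))) where

    Hangs : Fin (n G) → Set
    Hangs v = ∃ λ t → Below T c t × v ∈ bag D t

    hangs? : ∀ v → Dec (Hangs v)
    hangs? v = any? λ t → below? T c t ×-dec (v ∈? bag D t)

    H Att Rest : Subset (n G)
    H = Late (toℕ c) ∩ ⟪ hangs? ⟫
    Att = H ─ bag D c
    Rest = Late (toℕ c) ─ H

    H⇒late : H ⊆ Late (toℕ c)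
    H⇒late = p∩q⊆p _ _

    H⇒hangs : ∀ {v} → v ∈ H → Hangs v
    H⇒hangs v∈ = ∈⟪⟫⁻ hangs? (p∩q⊆q (Late (toℕ c)) _ v∈)

    H⇒A : H ⊆ A
    H⇒A = x∈p─q⇒x∈p ∘ H⇒late

    ∈H : ∀ {v} → v ∈ Late (toℕ c) → Hangs v → v ∈ H
    ∈H v∈ h = x∈p∩q⁺ (v∈ , ∈⟪⟫⁺ hangs? h)

    -- Otherwise the walk between two bags of `v` would leave the subtree and meet a node of index
    -- below `c`, making `v` early.
    bags-of-H : ∀ {v t} → v ∈ H → v ∈ bag D t → Below T c t
    bags-of-H {v} {t} v∈H v∈t with H⇒hangs v∈H
    ... | d , b , v∈d with leave-subtree b (connected D v d t v∈d v∈t)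
    ...   | inj₁ b′ = b′
    ...   | inj₂ (_ , early) = ⊥-elim (late⁻ (H⇒late v∈H) early)

    early-suc : ∀ {v} → Early (suc (toℕ c)) v → Early (toℕ c) v ⊎ v ∈ bag D c
    early-suc {v} (t , s≤s t≤c , v∈t) with t ≟ c
    ... | yes refl = inj₂ v∈t
    ... | no t≢c = inj₁ (t , ≤∧≢⇒< t≤c (t≢c ∘ toℕ-injective) , v∈t)

    late-suc : ∀ {v} → v ∈ Late (toℕ c) → v ∉ bag D c → v ∈ Late (suc (toℕ c))
    late-suc v∈ v∉ = late⁺ (x∈p─q⇒x∈p v∈) λ early → [ late⁻ v∈ , v∉ ] (early-suc early)

    late-pred : Late (suc (toℕ c)) ⊆ Late (toℕ c)
    late-pred v∈ = late⁺ (x∈p─q⇒x∈p v∈) λ (t , t<c , v∈t) → late⁻ v∈ (t , m<n⇒m<1+n t<c , v∈t)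

    -- The common bag of `u` and `x` lies below `c`. If `x` is late, it hangs below `c` as well, so
    -- it is in `Att` unless in the bag of `c`; if it is early, its bags leave the subtree, which
    -- they can do only through `c`.
    boundary-in-bag : ∀ {u x} → u ∈ H → x ∈ A → x ∉ Att → a u x ≢ 0 → x ∈ bag D c
    boundary-in-bag {u} {x} u∈H x∈A x∉Att adj with x ∈? bag D c | common-bag (H⇒A u∈H) x∈A adj
    ... | yes x∈c | _ = x∈c
    ... | no x∉c | t , u∈t , x∈t with early? (toℕ c) x
    ...   | no ¬early = ⊥-elim (x∉Att (x∈p∧x∉q⇒x∈p─q (∈H (late⁺ x∈A ¬early) (t , bags-of-H u∈H u∈t , x∈t)) x∉c))
    ...   | yes (p , p<c , x∈p) with leave-subtree (bags-of-H u∈H u∈t) (connected D x t p x∈t x∈p)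
    ...     | inj₁ b = ⊥-elim (<⇒≱ p<c (below⇒≤ b))
    ...     | inj₂ (x∈c , _) = x∈c

    -- Neighbours of `C` outside `C` lie outside the whole late region, so the elimination of that
    -- region restricts to `C` without larger bags.
    closed-part : ∀ {C} → C ⊆ Late (suc (toℕ c)) → (∀ {u x} → u ∈ C → x ∈ Late (suc (toℕ c)) → x ∉ C → a u x ≡ 0) →
                  Good k A C
    closed-part {C} C⊆ closed = subst (λ k → Good k A C) (+-identityʳ k)
      (good-restrict ⊥ gLate x∈p─q⇒x∈p C⊆ (≤-reflexive (∣⊥∣≡0 (n G)))
        λ {u} {x} u∈ x∈ x∉ adj → case x ∈? Late (suc (toℕ c)) of λ where
          (yes x∈L) → ⊥-elim (adj (closed u∈ x∈L x∉))
          (no x∉L) → inj₁ (x∈ , x∉L))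

    bag-early : ∀ {x} → x ∈ bag D c → Early (suc (toℕ c)) x
    bag-early x∈ = c , ≤-refl , x∈

    good-Att : Good k A Att
    good-Att = closed-part (λ x∈ → late-suc (H⇒late (x∈p─q⇒x∈p x∈)) (x∈p─q⇒x∉q x∈)) closed
      where
      closed : ∀ {u x} → u ∈ Att → x ∈ Late (suc (toℕ c)) → x ∉ Att → a u x ≡ 0
      closed {u} {x} u∈ x∈ x∉ with a u x ℕ.≟ 0
      ... | yes eq = eq
      ... | no adj = ⊥-elim (late⁻ x∈ (bag-early (boundary-in-bag (x∈p─q⇒x∈p u∈) (x∈p─q⇒x∈p x∈) x∉ adj)))

    -- The vertices of `H` in the bag of `c` are eliminated within that bag. What remains is `Att`,
    -- and at every stage the boundary stays in the bag.
    good-H : Good k A H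
    good-H = good-fill (bag D c) good-Att x∈p─q⇒x∈p private⊆ (bag≤k c) λ Att⊆ E⊆ x∈N →
      let x∈A , x∉E , u , u∈E , adj = N⁻ x∈N in boundary-in-bag (E⊆ u∈E) x∈A (x∉E ∘ Att⊆) adj
      where
      private⊆ : H ─ Att ⊆ bag D c
      private⊆ x∈ = ∪-elim id (⊥-elim ∘ x∈p─q⇒x∉q x∈) (p⊆q∪p─q (bag D c) (x∈p─q⇒x∈p x∈))

    H-Rest : NoEdge H Rest
    H-Rest {u} {x} u∈ x∈ with a u x ℕ.≟ 0
    ... | yes eq = eq
    ... | no adj = ⊥-elim (x∈p─q⇒x∉q x∈ (∈H (x∈p─q⇒x∈p x∈) (t , bags-of-H u∈ u∈t , x∈t)))
      where
      cb = common-bag (H⇒A u∈) (x∈p─q⇒x∈p (x∈p─q⇒x∈p x∈)) adj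
      t = proj₁ cb
      u∈t = proj₁ (proj₂ cb)
      x∈t = proj₂ (proj₂ cb)

    good-Rest : Good k A Rest
    good-Rest = closed-part
      (λ x∈ → late-suc (x∈p─q⇒x∈p x∈) λ x∈c → x∈p─q⇒x∉q x∈ (∈H (x∈p─q⇒x∈p x∈) (c , here , x∈c)))
      λ {u} {x} u∈ x∈ x∉ → case x ∈? H of λ where
        (yes x∈H) → trans (multiplicity-sym (edges G) u x) (H-Rest x∈H u∈)
        (no x∉H) → ⊥-elim (x∉ (x∈p∧x∉q⇒x∈p─q (late-pred x∈) x∉H))

    good-Late : Good k A (Late (toℕ c))
    good-Late = good-glue good-H good-Rest H⇒late x∈p─q⇒x∈p
      (p⊆q∪p─q H)
      (λ x∈H x∈R → x∈p─q⇒x∉q x∈R x∈H) H-Rest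

  good-all-late : ∀ j c → c + j ≡ suc (m T) → Good k A (Late c)
  -- Past the last node no vertex is left, because each lies in some bag.
  good-all-late zero c eq = done λ (x , x∈) → let t , x∈t = covers D x (x∈p─q⇒x∈p x∈) in
    late⁻ x∈ (t , <-≤-trans (toℕ<n t) (≤-reflexive (trans (sym eq) (+-identityʳ c))) , x∈t)
  good-all-late (suc j) c eq = subst (λ c → Good k A (Late c)) toℕi≡c
      (Step.good-Late i (subst (λ c → Good k A (Late (suc c))) (sym toℕi≡c) (good-all-late j (suc c) eq′)))
    where
    eq′ : suc c + j ≡ suc (m T)
    eq′ = trans (sym (+-suc c j)) eq
    c<m : c < suc (m T)
    c<m = ≤-trans (m≤m+n (suc c) j) (≤-reflexive eq′)
    i = fromℕ< c<m
    toℕi≡c = toℕ-fromℕ< c<m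

  small : Small k A
  small = subst (Good k A) (⊆-antisym x∈p─q⇒x∈p λ x∈ → late⁺ {0} x∈ λ ()) (good-all-late (suc (m T)) 0 refl)

-- From elimination orders to tree decompositions

≤-foldr-⊔ : ∀ {x xs} → x ∈ˡ xs → x ≤ foldr _⊔_ 0 xs
≤-foldr-⊔ {xs = y ∷ ys} (here refl) = m≤m⊔n y _
≤-foldr-⊔ {xs = y ∷ ys} (there x∈) = ≤-trans (≤-foldr-⊔ x∈) (m≤n⊔m y _)

foldr-⊔-≤ : ∀ {k xs} → All (_≤ k) xs → foldr _⊔_ 0 xs ≤ k
foldr-⊔-≤ [] = z≤n
foldr-⊔-≤ (p ∷ ps) = ⊔-lub p (foldr-⊔-≤ ps)

module Update {I X : Set} (_≟ᴵ_ : DecidableEquality I) where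
  update : (I → X) → I → X → I → X
  update f i x j = if does (j ≟ᴵ i) then x else f j

  update-≡ : ∀ f i x → update f i x i ≡ x
  update-≡ f i x rewrite dec-true (i ≟ᴵ i) refl = refl

  update-≢ : ∀ f {i} x {j} → j ≢ i → update f i x j ≡ f j
  update-≢ f {i} x {j} j≢i rewrite dec-false (j ≟ᴵ i) j≢i = refl

reach-end : ∀ {T S i j} → Reach T S i j → S j
reach-end (here s) = s
reach-end (step _ _ s) = s

reach-trans : ∀ {T S i j k} → Reach T S i j → Reach T S j k → Reach T S i k
reach-trans r (here _) = r
reach-trans r (step r′ adj s) = step (reach-trans r r′) adj s

reach-sym : ∀ {T S i j} → Reach T S i j → Reach T S j i
reach-sym (here s) = here s
reach-sym {T} (step r adj s) = reach-trans (step (here s) (flip adj) (reach-end r)) (reach-sym r)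
  where
  flip : ∀ {k l} → TAdj T k l → TAdj T l k
  flip (up i) = down i
  flip (down i) = up i

module ToTD (G : Graph) (k : ℕ) where
  private
    a = multiplicity (edges G)
    V = Subset (n G)
  open EdgeWeights a (multiplicity-sym (edges G))
  open Update

  -- A tree decomposition of G[P] under construction, with node set {0, …, last} and values beyond it
  -- meaningless; top v is the node of smallest depth whose bag contains v.
  record Partial (P : V) : Set where
    field
      last    : ℕ
      parent  : ℕ → ℕ
      bags    : ℕ → V
      top     : Fin (n G) → ℕ
      parent≤ : ∀ i → i < last → parent i ≤ i
      bags≤   : ∀ {t} → t ≤ last → ∣ bags t ∣ ≤ k
      covered : ∀ {v} → v ∈ P → ∃ λ t → t ≤ last × v ∈ bags t
      joined  : ∀ {u v} → u ∈ P → v ∈ P → a u v ≢ 0 → ∃ λ t → t ≤ last × u ∈ bags t × v ∈ bags t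
      climb   : ∀ {i v} → i < last → v ∈ bags (suc i) → v ∈ bags (parent i) ⊎ top v ≡ suc i
      at-root : ∀ {v} → v ∈ bags 0 → top v ≡ 0
      bags⊆   : ∀ {t} → t ≤ last → bags t ⊆ P
  open Partial

  -- Apart from `v`, the new bag only repeats vertices of the bag of `p`, so their bags stay
  -- connected. The new node is the top of `v`, and its bag holds all edges from `v` to `P`.
  add-leaf : ∀ {P} (s : Partial P) v B {p} → p ≤ last s → v ∉ P → v ∈ B → B ⊆ bags s p ∪ ⁅ v ⁆ → ∣ B ∣ ≤ k →
             (∀ {u} → u ∈ P → a u v ≢ 0 → u ∈ B) →
             Σ (Partial (P ∪ ⁅ v ⁆)) λ s′ → last s′ ≡ suc (last s) × bags s′ (suc (last s)) ≡ B ×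
               (∀ {t} → t ≤ last s → bags s′ t ≡ bags s t)
  add-leaf {P} s v B {p} p≤ v∉P v∈B B⊆ ∣B∣≤k nbrs = s′ , refl , bag-new , bag-old
    where
    L = last s
    bags′ = update ℕ._≟_ (bags s) (suc L) B
    -- `parent i` belongs to node `suc i`, so the parent of the new node `suc L` is stored at `L`.
    parent′ = update ℕ._≟_ (parent s) L p
    top′ = update _≟_ (top s) v (suc L)
    bag-new : bags′ (suc L) ≡ B
    bag-new = update-≡ ℕ._≟_ (bags s) (suc L) B
    bag-old : ∀ {t} → t ≤ L → bags′ t ≡ bags s t
    bag-old t≤L = update-≢ ℕ._≟_ (bags s) B (<⇒≢ (s≤s t≤L))
    old : ∀ {t u} → t ≤ L → u ∈ bags s t → u ∈ bags′ t
    old t≤L = subst (_ ∈_) (sym (bag-old t≤L))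
    old⁻ : ∀ {t u} → t ≤ L → u ∈ bags′ t → u ∈ bags s t
    old⁻ t≤L = subst (_ ∈_) (bag-old t≤L)
    new : ∀ {u} → u ∈ B → u ∈ bags′ (suc L)
    new = subst (_ ∈_) (sym bag-new)
    new⁻ : ∀ {u} → u ∈ bags′ (suc L) → u ∈ B
    new⁻ = subst (_ ∈_) bag-new
    top-old : ∀ {u} → u ∈ P → top′ u ≡ top s u
    top-old u∈ = update-≢ _≟_ (top s) (suc L) λ { refl → v∉P u∈ }
    old-or-new : ∀ {t} → t ≤ suc L → t ≤ L ⊎ t ≡ suc L
    old-or-new t≤ = [ inj₁ ∘ ≤-pred , inj₂ ] (m≤n⇒m<n∨m≡n t≤)
    is-v : ∀ {u} → u ∈ ⁅ v ⁆ → u ≡ v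
    is-v = x∈⁅y⁆⇒x≡y v
    s′ : Partial (P ∪ ⁅ v ⁆)
    s′ .last = suc L
    s′ .parent = parent′
    s′ .bags = bags′
    s′ .top = top′
    s′ .parent≤ i i< with m≤n⇒m<n∨m≡n (≤-pred i<)
    ... | inj₁ i<L = subst (_≤ i) (sym (update-≢ ℕ._≟_ (parent s) p (<⇒≢ i<L))) (parent≤ s i i<L)
    ... | inj₂ refl = subst (_≤ L) (sym (update-≡ ℕ._≟_ (parent s) L p)) p≤
    s′ .bags≤ t≤ with old-or-new t≤
    ... | inj₁ t≤L = subst (λ b → ∣ b ∣ ≤ k) (sym (bag-old t≤L)) (bags≤ s t≤L)
    ... | inj₂ refl = subst (λ b → ∣ b ∣ ≤ k) (sym bag-new) ∣B∣≤k
    s′ .covered u∈ with ∈∪-either u∈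
    ... | inj₁ u∈P = let t , t≤ , u∈t = covered s u∈P in t , m≤n⇒m≤1+n t≤ , old t≤ u∈t
    ... | inj₂ u∈v rewrite is-v u∈v = suc L , ≤-refl , new v∈B
    s′ .joined {u} {w} u∈ w∈ adj with ∈∪-either u∈ | ∈∪-either w∈
    ... | inj₁ u∈P | inj₁ w∈P =
      let t , t≤ , u∈t , w∈t = joined s u∈P w∈P adj in t , m≤n⇒m≤1+n t≤ , old t≤ u∈t , old t≤ w∈t
    ... | inj₁ u∈P | inj₂ w∈v rewrite is-v w∈v = suc L , ≤-refl , new (nbrs u∈P adj) , new v∈B
    ... | inj₂ u∈v | inj₁ w∈P rewrite is-v u∈v =
      suc L , ≤-refl , new v∈B , new (nbrs w∈P (adj ∘ trans (multiplicity-sym (edges G) v w)))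
    ... | inj₂ u∈v | inj₂ w∈v rewrite is-v u∈v | is-v w∈v = suc L , ≤-refl , new v∈B , new v∈B
    s′ .climb {i} {u} i< u∈ with m≤n⇒m<n∨m≡n (≤-pred i<)
    ... | inj₁ i<L with u∈i ← old⁻ i<L u∈ with climb s i<L u∈i
    ...   | inj₁ u∈p = inj₁ (subst (λ q → u ∈ bags′ q) (sym (update-≢ ℕ._≟_ (parent s) p (<⇒≢ i<L)))
                         (old (≤-trans (parent≤ s i i<L) (<⇒≤ i<L)) u∈p))
    ...   | inj₂ eq = inj₂ (trans (top-old (bags⊆ s i<L u∈i)) eq)
    s′ .climb {i} {u} i< u∈ | inj₂ refl with ∈∪-either (B⊆ (new⁻ u∈))
    ... | inj₁ u∈p = inj₁ (subst (λ q → u ∈ bags′ q) (sym (update-≡ ℕ._≟_ (parent s) L p)) (old p≤ u∈p))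
    ... | inj₂ u∈v rewrite is-v u∈v = inj₂ (update-≡ _≟_ (top s) v (suc L))
    s′ .at-root u∈ = let u∈0 = old⁻ z≤n u∈ in trans (top-old (bags⊆ s z≤n u∈0)) (at-root s u∈0)
    s′ .bags⊆ t≤ u∈ with old-or-new t≤
    ... | inj₁ t≤L = ∪ˡ (bags⊆ s t≤L (old⁻ t≤L u∈))
    ... | inj₂ refl with ∈∪-either (B⊆ (new⁻ u∈))
    ...   | inj₁ u∈p = ∪ˡ (bags⊆ s p≤ u∈p)
    ...   | inj₂ u∈v = ∪ʳ u∈v

  Extension : V → ∀ {P} → Partial P → Set
  Extension Q s = Σ (Partial Q) λ s′ → last s ≤ last s′ × (∀ {t} → t ≤ last s → bags s′ t ≡ bags s t)

  -- Each elimination bag becomes a leaf below a node whose bag contains the boundary of the current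
  -- region. After `add` the new leaf is such a node; after `split` both parts hang below the same
  -- `p`.
  attach : ∀ {C P p} → Good k ⊤ C → (s : Partial P) → (∀ {v} → v ∈ C → v ∉ P) → p ≤ last s → N ⊤ C ⊆ bags s p →
           Extension (P ∪ C) s
  attach {C} {P} (done empty) s _ _ _ = subst (λ Q → Extension Q s) P≡ (s , ≤-refl , λ _ → refl)
    where
    P≡ : P ≡ P ∪ C
    P≡ = ⊆-antisym (p⊆p∪q C) λ x∈ → [ id , (λ x∈C → ⊥-elim (empty (_ , x∈C))) ] (∈∪-either x∈)
  attach {C} {P} {p} (add v v∈ le g) s disj p≤ N⊆ =
    let s₁ , last≡ , new , old = add-leaf s v (N ⊤ C ∪ ⁅ v ⁆) p≤ (disj v∈) (∪ʳ (x∈⁅x⁆ v))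
           (λ x∈ → [ (λ x∈N → ∪ˡ (N⊆ x∈N)) , (λ x∈v → ∪ʳ x∈v) ] (∈∪-either x∈)) le
           (λ u∈P adj → ∪ˡ (N⁺ v∈ ∈⊤ (λ u∈C → disj u∈C u∈P) (adj ∘ trans (multiplicity-sym (edges G) _ v))))
        s₂ , last≤ , old₂ = attach g s₁ disj′ (≤-reflexive (sym last≡))
                               (subst (N ⊤ (C - v) ⊆_) (sym new) (N-delete v))
    in subst (λ Q → Extension Q s) P≡ (s₂ , ≤-trans (grown last≡) last≤ ,
      λ t≤ → trans (old₂ (≤-trans t≤ (grown last≡))) (old t≤))
    where
    grown : ∀ {l} → l ≡ suc (last s) → last s ≤ l
    grown refl = n≤1+n _
    disj′ : ∀ {u} → u ∈ C - v → u ∉ P ∪ ⁅ v ⁆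
    disj′ u∈ = [ disj (x∈p─q⇒x∈p u∈) , x∈p-y⇒x≢y u∈ ∘ x∈⁅y⁆⇒x≡y v ] ∘ ∈∪-either
    P≡ : (P ∪ ⁅ v ⁆) ∪ (C - v) ≡ P ∪ C
    P≡ = ⊆-antisym
      (λ x∈ → case ∈∪-either x∈ of λ where
        (inj₂ x∈C) → ∪ʳ (x∈p─q⇒x∈p x∈C)
        (inj₁ x∈Pv) → case ∈∪-either x∈Pv of λ where
          (inj₁ x∈P) → ∪ˡ x∈P
          (inj₂ x∈v) → ∪ʳ (subst (_∈ C) (sym (x∈⁅y⁆⇒x≡y v x∈v)) v∈))
      (λ {x} x∈ → case ∈∪-either x∈ of λ where
        (inj₁ x∈P) → ∪ˡ (∪ˡ x∈P)
        (inj₂ x∈C) → case x ≟ v of λ where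
          (yes refl) → ∪ˡ (∪ʳ (x∈⁅x⁆ x))
          (no x≢v) → ∪ʳ (x∈p∧x≢y⇒x∈p-y x∈C x≢v))
  attach {C} {P} {p} (split D D⊆ _ _ ne g₁ g₂) s disj p≤ N⊆ =
    let s₁ , last₁ , old₁ = attach g₁ s (disj ∘ D⊆) p≤ (N⊆ ∘ N-part D⊆ ne)
        s₂ , last₂ , old₂ = attach g₂ s₁ disj₂ (≤-trans p≤ last₁)
                               (subst (N ⊤ (C ─ D) ⊆_) (sym (old₁ p≤)) (N⊆ ∘ N-rest ne))
    in subst (λ Q → Extension Q s) P≡ (s₂ , ≤-trans last₁ last₂ ,
      λ t≤ → trans (old₂ (≤-trans t≤ last₁)) (old₁ t≤))
    where
    disj₂ : ∀ {u} → u ∈ C ─ D → u ∉ P ∪ D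
    disj₂ u∈ = [ disj (x∈p─q⇒x∈p u∈) , x∈p─q⇒x∉q u∈ ] ∘ ∈∪-either
    P≡ : (P ∪ D) ∪ (C ─ D) ≡ P ∪ C
    P≡ = ⊆-antisym
      (λ x∈ → case ∈∪-either x∈ of λ where
        (inj₂ x∈C) → ∪ʳ (x∈p─q⇒x∈p x∈C)
        (inj₁ x∈PD) → case ∈∪-either x∈PD of λ where
          (inj₁ x∈P) → ∪ˡ x∈P
          (inj₂ x∈D) → ∪ʳ (D⊆ x∈D))
      (λ {x} x∈ → case ∈∪-either x∈ of λ where
        (inj₁ x∈P) → ∪ˡ (∪ˡ x∈P)
        (inj₂ x∈C) → case x ∈? D of λ where
          (yes x∈D) → ∪ˡ (∪ʳ x∈D)
          (no x∉D) → ∪ʳ (x∈p∧x∉q⇒x∈p─q x∈C x∉D))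

  module Finish (s : Partial ⊤) where
    T : Tree
    T .m = last s
    T .par i = fromℕ< (s≤s (≤-trans (parent≤ s (toℕ i) (toℕ<n i)) (<⇒≤ (toℕ<n i))))
    T .parLt i = ≤-trans (≤-reflexive (toℕ-fromℕ< _)) (parent≤ s (toℕ i) (toℕ<n i))

    toℕ≤ : (t : Fin (suc (last s))) → toℕ t ≤ last s
    toℕ≤ t = ≤-pred (toℕ<n t)

    toℕ-par : ∀ i → toℕ (par T i) ≡ parent s (toℕ i)
    toℕ-par i = toℕ-fromℕ< _

    -- All nodes whose bags contain `v` reach the same node this way, whence any two of them are
    -- joined inside the bags of `v`.
    climb-to-top : ∀ v f t → toℕ t ≤ f → v ∈ bags s (toℕ t) →
                   ∃ λ r → toℕ r ≡ top s v × Reach T (λ t → v ∈ bags s (toℕ t)) t r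
    climb-to-top v f zero _ v∈ = zero , sym (at-root s v∈) , here v∈
    climb-to-top v (suc f) (suc i) (s≤s i≤f) v∈ with climb s (toℕ<n i) v∈
    ... | inj₂ eq = suc i , sym eq , here v∈
    ... | inj₁ v∈p =
      let v∈p′ = subst (λ q → v ∈ bags s q) (sym (toℕ-par i)) v∈p
          r , eq , walk = climb-to-top v f (par T i) (≤-trans (parLt T i) i≤f) v∈p′
      in r , eq , reach-trans (step (here v∈) (up i) v∈p′) walk

    at : ∀ (Q : ℕ → Set) {t} → t ≤ last s → Q t → Σ (Fin (suc (last s))) λ t → Q (toℕ t)
    at Q t≤ q = fromℕ< (s≤s t≤) , subst Q (sym (toℕ-fromℕ< (s≤s t≤))) q

    decomposition : TreeDecomposition G ⊤
    decomposition .tree = T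
    decomposition .bag t = bags s (toℕ t)
    decomposition .bagInA _ _ _ = ∈⊤
    decomposition .covers v v∈ = let t , t≤ , v∈t = covered s v∈ in at (λ t → v ∈ bags s t) t≤ v∈t
    decomposition .edgeCov = All.tabulate λ {(x , y)} e∈ u∈ v∈ →
      let t , t≤ , both = joined s u∈ v∈ (∈⇒multiplicity≢0 e∈) in at (λ t → x ∈ bags s t × y ∈ bags s t) t≤ both
    decomposition .connected v i j v∈i v∈j =
      let r , eq , walk = climb-to-top v _ i ≤-refl v∈i
          r′ , eq′ , walk′ = climb-to-top v _ j ≤-refl v∈j
      in reach-trans walk (subst (λ r → Reach T _ r j) (toℕ-injective (trans eq′ (sym eq))) (reach-sym walk′))

    width≤ : width decomposition ≤ k ∸ 1
    width≤ = ∸-monoˡ-≤ 1 (foldr-⊔-≤ (All-map⁺ (All.universal (λ t → bags≤ s (toℕ≤ t)) (allFin (suc (last s))))))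

  -- Trees are nonempty, so the construction starts from one node with an empty bag.
  empty-partial : Partial ⊥
  empty-partial .last = 0
  empty-partial .parent _ = 0
  empty-partial .bags _ = ⊥
  empty-partial .top _ = 0
  empty-partial .parent≤ _ ()
  empty-partial .bags≤ _ = ≤-trans (≤-reflexive (∣⊥∣≡0 (n G))) z≤n
  empty-partial .covered v∈ = ⊥-elim (∉⊥ v∈)
  empty-partial .joined u∈ = ⊥-elim (∉⊥ u∈)
  empty-partial .climb ()
  empty-partial .at-root _ = refl
  empty-partial .bags⊆ _ v∈ = v∈

  small⇒decomposition : Small k ⊤ → Σ (TreeDecomposition G ⊤) λ D → width D ≤ k ∸ 1
  small⇒decomposition g =
    let s , _ = attach g empty-partial (λ _ → ∉⊥) z≤n (λ x∈ → ⊥-elim (proj₁ (proj₂ (N⁻ x∈)) ∈⊤))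
        s′ = subst Partial (⊆-antisym (λ _ → ∈⊤) λ _ → ∪ʳ ∈⊤) s
    in Finish.decomposition s′ , Finish.width≤ s′

-- A decomposition of width below `k` has bags of size at most `k`, and so would make `A` small.
large⇒TwAtLeast : ∀ G A k →
                  ¬ EdgeWeights.Small (multiplicity (edges G)) (multiplicity-sym (edges G)) k A → TwAtLeast G A k
large⇒TwAtLeast G A k large D with k ≤? width D
... | yes k≤ = k≤
... | no k≰ = ⊥-elim (large (FromTD.small G A D k λ t → ≤-trans (bag≤max t) max≤k))
  where
  sizes = map (λ t → ∣ bag D t ∣) (allFin (suc (m (tree D))))
  bag≤max : ∀ t → ∣ bag D t ∣ ≤ foldr _⊔_ 0 sizes
  bag≤max t = ≤-foldr-⊔ (∈-map⁺ (λ t → ∣ bag D t ∣) (∈-allFin t))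
  max≤k : foldr _⊔_ 0 sizes ≤ k
  max≤k = ≤-trans (m≤n+m∸n (foldr _⊔_ 0 sizes) 1) (≰⇒> k≰)

-- Improving a partition

≤-from-+ : ∀ {x y l r} → l ≤ r → x + r ≤ y + l → x ≤ y
≤-from-+ {x} {y} {l} {r} l≤r h = +-cancelʳ-≤ r x y (≤-trans h (+-monoʳ-≤ y l≤r))

sep-add : ∀ {W c c′ d} → 2 * W < 3 * c → c ≤ c′ + d → W ≤ 3 * c′ + 3 * d
sep-add {W} {c} {c′} {d} h c≤ = begin
  W               ≤⟨ m≤m+n W _ ⟩
  2 * W           ≤⟨ <⇒≤ h ⟩
  3 * c           ≤⟨ *-monoʳ-≤ 3 c≤ ⟩
  3 * (c′ + d)    ≡⟨ *-distribˡ-+ 3 c′ d ⟩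
  3 * c′ + 3 * d  ∎
  where open ≤-Reasoning

sep-split : ∀ {W c x y d} → 2 * W < 3 * c → c ≤ x + y → y ≤ x → W ≤ 3 * x + 3 * d
sep-split {W} {c} {x} {y} {d} h c≤ y≤x = ≤-trans (*-cancelˡ-≤ 2 (begin
  2 * W         ≤⟨ <⇒≤ h ⟩
  3 * c         ≤⟨ *-monoʳ-≤ 3 (≤-trans c≤ (+-monoʳ-≤ x y≤x)) ⟩
  3 * (x + x)   ≡⟨ eq x ⟩
  2 * (3 * x)   ∎)) (m≤m+n (3 * x) _)
  where
  open ≤-Reasoning
  eq : ∀ x → 3 * (x + x) ≡ 2 * (3 * x)
  eq = solve-∀

-- Here and below, `b` and `b′` count the edges leaving a set and one of its two parts, `f` and `f′`
-- those leaving the set from either part, and `σ` those between the parts.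
part-inside : ∀ {b′ b f σ s} → b′ ≤ f + σ → 3 * f ≤ 2 * b → σ ≤ s → 3 * b′ ≤ 2 * b + 6 * s
part-inside {b′} {b} {f} {σ} {s} b′≤ f≤ σ≤ = begin
  3 * b′          ≤⟨ *-monoʳ-≤ 3 b′≤ ⟩
  3 * (f + σ)     ≡⟨ *-distribˡ-+ 3 f σ ⟩
  3 * f + 3 * σ   ≤⟨ +-mono-≤ f≤ (≤-trans (*-monoʳ-≤ 3 σ≤) (*-monoˡ-≤ s {3} {6} (m≤m+n 3 3))) ⟩
  2 * b + 6 * s   ∎
  where open ≤-Reasoning

part-outside : ∀ {b′ b f f′ σ s d} → b′ ≤ f′ + σ → f + f′ ≤ b → b ≤ 3 * f + 3 * d → d ≤ s → σ ≤ s →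
               3 * b′ ≤ 2 * b + 6 * s
part-outside {b′} {b} {f} {f′} {σ} {s} {d} b′≤ f+f′≤ b≤ d≤ σ≤ = ≤-from-+ b≤ (begin
  3 * b′ + (3 * f + 3 * d)                ≤⟨ +-mono-≤ (*-monoʳ-≤ 3 b′≤) (+-monoʳ-≤ (3 * f) (*-monoʳ-≤ 3 d≤)) ⟩
  3 * (f′ + σ) + (3 * f + 3 * s)          ≤⟨ +-monoˡ-≤ (3 * f + 3 * s) (*-monoʳ-≤ 3 (+-monoʳ-≤ f′ σ≤)) ⟩
  3 * (f′ + s) + (3 * f + 3 * s)          ≡⟨ eq₁ f f′ s ⟩
  3 * (f + f′) + 6 * s                    ≤⟨ +-monoˡ-≤ (6 * s) (*-monoʳ-≤ 3 f+f′≤) ⟩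
  3 * b + 6 * s                           ≡⟨ eq₂ b s ⟩
  2 * b + 6 * s + b                       ∎)
  where
  open ≤-Reasoning
  eq₁ : ∀ f f′ s → 3 * (f′ + s) + (3 * f + 3 * s) ≡ 3 * (f + f′) + 6 * s
  eq₁ = solve-∀
  eq₂ : ∀ b s → 3 * b + 6 * s ≡ 2 * b + 6 * s + b
  eq₂ = solve-∀

part-decreases : ∀ {b′ b s} → 60 * s < b → 3 * b′ ≤ 2 * b + 6 * s → b′ < b
part-decreases {b′} {b} {s} s<b b′≤ = *-cancelˡ-< 3 b′ b (begin-strict
  3 * b′          ≤⟨ b′≤ ⟩
  2 * b + 6 * s   <⟨ +-monoʳ-< (2 * b) (≤-<-trans (*-monoˡ-≤ s {6} {60} (m≤m+n 6 54)) s<b) ⟩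
  2 * b + b       ≡⟨ +-comm (2 * b) b ⟩
  3 * b           ∎)
  where open ≤-Reasoning

-- After tripling, the newly cut edges cost `54 * s` and the estimate of `b′` costs `6 * s`. One
-- spare `b` pays for both, which is the origin of the threshold `60 * s`.
sweep-step : ∀ {ε ε′ σ b b′ s κ} → 18 * ε′ ≤ b′ + κ → ε ≤ ε′ + σ → σ ≤ s → 3 * b′ ≤ 2 * b + 6 * s →
             60 * s < b → 18 * ε ≤ b + κ
sweep-step {ε} {ε′} {σ} {b} {b′} {s} {κ} h ε≤ σ≤ b′≤ s<b = *-cancelˡ-≤ 3 (begin
  3 * (18 * ε)                        ≤⟨ *-monoʳ-≤ 3 (*-monoʳ-≤ 18 (≤-trans ε≤ (+-monoʳ-≤ ε′ σ≤))) ⟩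
  3 * (18 * (ε′ + s))                 ≡⟨ eq₁ ε′ s ⟩
  3 * (18 * ε′) + 54 * s              ≤⟨ +-monoˡ-≤ (54 * s) (*-monoʳ-≤ 3 h) ⟩
  3 * (b′ + κ) + 54 * s               ≡⟨ eq₂ b′ κ s ⟩
  3 * b′ + (3 * κ + 54 * s)           ≤⟨ +-monoˡ-≤ (3 * κ + 54 * s) b′≤ ⟩
  2 * b + 6 * s + (3 * κ + 54 * s)    ≡⟨ eq₃ b κ s ⟩
  2 * b + 3 * κ + 60 * s              ≤⟨ +-monoʳ-≤ (2 * b + 3 * κ) (<⇒≤ s<b) ⟩
  2 * b + 3 * κ + b                   ≡⟨ eq₄ b κ ⟩
  3 * (b + κ)                         ∎)
  where
  open ≤-Reasoning
  eq₁ : ∀ ε s → 3 * (18 * (ε + s)) ≡ 3 * (18 * ε) + 54 * s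
  eq₁ = solve-∀
  eq₂ : ∀ b κ s → 3 * (b + κ) + 54 * s ≡ 3 * b + (3 * κ + 54 * s)
  eq₂ = solve-∀
  eq₃ : ∀ b κ s → 2 * b + 6 * s + (3 * κ + 54 * s) ≡ 2 * b + 3 * κ + 60 * s
  eq₃ = solve-∀
  eq₄ : ∀ b κ → 2 * b + 3 * κ + b ≡ 3 * (b + κ)
  eq₄ = solve-∀

-- `x`, `y`, `z`, `u` stand for the old edges of `A₂B₂`, `A₂B₁`, `A₁B₂`, `A₁B₁`, and `t` for those
-- cut inside `A₁`. All but `x` may cross afterwards, together with two separators.
swap-bound : ∀ {ε x y z u t b c s κ} → ε ≤ (s + y) + ((z + s) + (t + u)) → (x + y) + (z + u) ≤ c →
             18 * t ≤ b + κ → b ≤ c + s → 18 * (ε + x) ≤ 19 * c + 37 * s + κ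
swap-bound {ε} {x} {y} {z} {u} {t} {b} {c} {s} {κ} ε≤ sum≤ t≤ b≤ = begin
  18 * (ε + x)                                        ≤⟨ *-monoʳ-≤ 18 (+-monoˡ-≤ x ε≤) ⟩
  18 * ((s + y) + ((z + s) + (t + u)) + x)            ≡⟨ eq₁ x y z u t s ⟩
  18 * ((x + y) + (z + u)) + 36 * s + 18 * t          ≤⟨ +-mono-≤ (+-monoˡ-≤ (36 * s) (*-monoʳ-≤ 18 sum≤))
                                                           (≤-trans t≤ (+-monoˡ-≤ κ b≤)) ⟩
  18 * c + 36 * s + (c + s + κ)                       ≡⟨ eq₂ c s κ ⟩
  19 * c + 37 * s + κ                                 ∎
  where
  open ≤-Reasoning
  eq₁ : ∀ x y z u t s → 18 * ((s + y) + ((z + s) + (t + u)) + x) ≡ 18 * ((x + y) + (z + u)) + 36 * s + 18 * t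
  eq₁ = solve-∀
  eq₂ : ∀ c s κ → 18 * c + 36 * s + (c + s + κ) ≡ 19 * c + 37 * s + κ
  eq₂ = solve-∀

-- Twice the hypothesis on `x` trades `18 * x` for `2 * c` and leaves `17 * c`. The errors add up to
-- `37 + 18 * 60 + 24 = 1141` multiples of `s * d`.
swap-decreases : ∀ {ε x c s d} → 18 * (ε + x) ≤ 19 * c + 37 * s + 18 * (60 * s * d) → c ≤ 9 * x + 12 * d →
                 1 ≤ d → 1 ≤ s → 1141 * (s * d) < c → ε < c
swap-decreases {ε} {x} {c} {s} {d} bound gain 1≤d 1≤s large = *-cancelˡ-< 18 ε c (begin-strict
  18 * ε                                                   ≤⟨ ≤-from-+ {18 * ε} gained (≤-reflexive (eq₁ ε x c s d)) ⟩
  17 * c + (37 * s + 18 * (60 * s * d) + 24 * d)           ≤⟨ +-monoʳ-≤ (17 * c)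
      (+-mono-≤ (+-monoˡ-≤ _ (*-monoʳ-≤ 37 s≤)) (*-monoʳ-≤ 24 d≤)) ⟩
  17 * c + (37 * (s * d) + 18 * (60 * s * d) + 24 * (s * d)) ≡⟨ cong (17 * c +_) (eq₂ s d) ⟩
  17 * c + 1141 * (s * d)                                  <⟨ +-monoʳ-< (17 * c) large ⟩
  17 * c + c                                               ≡⟨ +-comm (17 * c) c ⟩
  18 * c                                                   ∎)
  where
  open ≤-Reasoning
  s≤ : s ≤ s * d
  s≤ = m≤m*n s d {{ℕ.>-nonZero 1≤d}}
  d≤ : d ≤ s * d
  d≤ = m≤n*m d s {{ℕ.>-nonZero 1≤s}}
  gained : 18 * (ε + x) + 2 * c ≤ 19 * c + 37 * s + 18 * (60 * s * d) + 2 * (9 * x + 12 * d)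
  gained = +-mono-≤ bound (*-monoʳ-≤ 2 gain)
  eq₁ : ∀ ε x c s d → 18 * ε + (19 * c + 37 * s + 18 * (60 * s * d) + 2 * (9 * x + 12 * d)) ≡
                      17 * c + (37 * s + 18 * (60 * s * d) + 24 * d) + (18 * (ε + x) + 2 * c)
  eq₁ = solve-∀
  eq₂ : ∀ s d → 37 * (s * d) + 18 * (60 * s * d) + 24 * (s * d) ≡ 1141 * (s * d)
  eq₂ = solve-∀

complement-heavy : ∀ {p x y} → p ≤ x + y → 3 * x ≤ 2 * p → p ≤ 3 * y
complement-heavy {p} {x} {y} p≤ x≤ = ≤-from-+ {p} x≤ (begin
  p + 2 * p        ≡⟨⟩
  3 * p            ≤⟨ *-monoʳ-≤ 3 p≤ ⟩
  3 * (x + y)      ≡⟨ *-distribˡ-+ 3 x y ⟩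
  3 * x + 3 * y    ≡⟨ +-comm (3 * x) (3 * y) ⟩
  3 * y + 3 * x    ∎)
  where open ≤-Reasoning

gain-of-part : ∀ {c p q d} → c ≤ 3 * p + 3 * d → p ≤ 3 * q + 3 * d → c ≤ 9 * q + 12 * d
gain-of-part {c} {p} {q} {d} c≤ p≤ = begin
  c                                ≤⟨ c≤ ⟩
  3 * p + 3 * d                    ≤⟨ +-monoˡ-≤ (3 * d) (*-monoʳ-≤ 3 p≤) ⟩
  3 * (3 * q + 3 * d) + 3 * d      ≡⟨ eq q d ⟩
  9 * q + 12 * d                   ∎
  where
  open ≤-Reasoning
  eq : ∀ q d → 3 * (3 * q + 3 * d) + 3 * d ≡ 9 * q + 12 * d
  eq = solve-∀

-- Half of a third is a sixth, weakened to the ninth of `gain-of-part` so that both diagonals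
-- satisfy the same bound.
gain-of-larger : ∀ {c p q r d} → c ≤ 3 * p → p ≤ q + r → r ≤ q → c ≤ 9 * q + 12 * d
gain-of-larger {c} {p} {q} {r} {d} c≤ p≤ r≤q = begin
  c                     ≤⟨ c≤ ⟩
  3 * p                 ≤⟨ *-monoʳ-≤ 3 (≤-trans p≤ (+-monoʳ-≤ q r≤q)) ⟩
  3 * (q + q)           ≤⟨ m≤m+n _ (3 * q + 12 * d) ⟩
  3 * (q + q) + (3 * q + 12 * d)  ≡⟨ eq q d ⟩
  9 * q + 12 * d        ∎
  where
  open ≤-Reasoning
  eq : ∀ q d → 3 * (q + q) + (3 * q + 12 * d) ≡ 9 * q + 12 * d
  eq = solve-∀

-- Balanced separators under a degree bound

module BoundedDegree {ν : ℕ} (a : Fin ν → Fin ν → ℕ) (a-sym : ∀ u v → a u v ≡ a v u)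
             (Δ : ℕ) (deg≤ : ∀ u → sum (a u) ≤ Δ) where
  open EdgeWeights a a-sym

  weight≤Δ : ∀ X u → weight (a u) X ≤ Δ
  weight≤Δ X u = ≤-trans (sum-mono λ v → value-≤ (a u) v λ _ → ≤-refl) (deg≤ u)

  -- All these edges end in `N A D`, and each vertex meets at most `Δ` edges.
  e-boundary : ∀ {A D} → D ⊆ A → e D (A ─ D) ≤ ∣ N A D ∣ * Δ
  e-boundary {A} {D} D⊆A = begin
    e D (A ─ D)                             ≤⟨ e-coverʳ D (p⊆q∪p─q (N A D)) ⟩
    e D (N A D) + e D ((A ─ D) ─ N A D)     ≡⟨ cong (e D (N A D) +_) (e-NoEdge none) ⟩
    e D (N A D) + 0                         ≡⟨ +-identityʳ _ ⟩
    e D (N A D)                             ≡⟨ e-sym D (N A D) ⟩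
    e (N A D) D                             ≤⟨ weight≤∣∣*k {X = N A D} (weight≤Δ D) ⟩
    ∣ N A D ∣ * Δ                           ∎
    where
    open ≤-Reasoning
    none : NoEdge D ((A ─ D) ─ N A D)
    none {u} {v} u∈ v∈ with a u v ℕ.≟ 0
    ... | yes eq = eq
    ... | no adj = let v∈A─D = x∈p─q⇒x∈p v∈ in
      ⊥-elim (x∈p─q⇒x∉q v∈ (N⁺ u∈ (x∈p─q⇒x∈p v∈A─D) (x∈p─q⇒x∉q v∈A─D) adj))

  touches? : ∀ A v → Dec (v ∈ A × weight (a v) (∁ A) ≢ 0)
  touches? A v = (v ∈? A) ×-dec ¬? (weight (a v) (∁ A) ℕ.≟ 0)

  ∂ : Subset ν → Subset ν
  ∂ A = ⟪ touches? A ⟫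

  ∂⊆A : ∀ {A} → ∂ A ⊆ A
  ∂⊆A {A} = proj₁ ∘ ∈⟪⟫⁻ (touches? A)

  ∣∂∣≤ : ∀ {A} → ∣ ∂ A ∣ ≤ e A (∁ A)
  ∣∂∣≤ {A} = ≤-trans
    (∣∣≤weight {f = λ v → weight (a v) (∁ A)} {∂ A} λ v∈ → n≢0⇒n>0 (proj₂ (∈⟪⟫⁻ (touches? A) v∈)))
    (e-mono {∂ A} {A} {∁ A} ∂⊆A id)

  interior : ∀ {A} → NoEdge (A ─ ∂ A) (∁ A)
  interior {A} {v} {u} v∈ u∈ with weight (a v) (∁ A) ℕ.≟ 0
  ... | yes none = n≤0⇒n≡0 (≤-trans (∈⇒≤weight (a v) u∈) (≤-reflexive none))
  ... | no some = ⊥-elim (x∈p─q⇒x∉q v∈ (∈⟪⟫⁺ (touches? A) (x∈p─q⇒x∈p v∈ , some)))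

  Balanced : ℕ → (Fin ν → ℕ) → Subset ν → Set
  Balanced k f A = ∃ λ D → D ⊆ A × weight f A ≤ 3 * weight f D + 3 * Δ ×
                           3 * weight f D ≤ 2 * weight f A × e D (A ─ D) ≤ k * Δ

  -- Follows the elimination until the region has at most two thirds of the weight. Before that,
  -- eliminating a vertex loses at most `Δ`, the source of the error term, and the heavier part of a
  -- split keeps more than a third of the total.
  descend : ∀ {k A C} (f : Fin ν → ℕ) → (∀ v → f v ≤ Δ) → Good k A C → C ⊆ A → ∣ N A C ∣ ≤ k →
            weight f A ≤ 3 * weight f C + 3 * Δ → Balanced k f A
  descend {k} {A} {C} f f≤ g C⊆A N≤k low with 3 * weight f C ≤? 2 * weight f A
  ... | yes high = C , C⊆A , low , high , ≤-trans (e-boundary C⊆A) (*-monoˡ-≤ Δ N≤k)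
  descend {k} {A} {C} f f≤ (done empty) C⊆A N≤k low | no heavy =
    ⊥-elim (heavy (subst (λ z → 3 * z ≤ 2 * weight f A) (sym (weight-empty f λ v∈ → ⊥-elim (empty (_ , v∈)))) z≤n))
  descend {k} {A} {C} f f≤ (add v v∈ le g) C⊆A N≤k low | no heavy =
    descend f f≤ g (C⊆A ∘ x∈p─q⇒x∈p) (≤-trans (p⊆q⇒∣p∣≤∣q∣ (N-delete v)) le)
      (sep-add {c = weight f C} {weight f (C - v)} {Δ} (≰⇒> heavy) drop)
    where
    drop : weight f C ≤ weight f (C - v) + Δ
    drop = ≤-trans (weight-cover f {Y = C - v} {⁅ v ⁆} (λ x∈ → ∪-elim ∪ʳ ∪ˡ (p⊆q∪p─q ⁅ v ⁆ x∈)))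
      (+-monoʳ-≤ _ (≤-trans (weight≤∣∣*k {X = ⁅ v ⁆} f≤)
        (≤-reflexive (trans (cong (_* Δ) (∣⁅x⁆∣≡1 v)) (*-identityˡ Δ)))))
  descend {k} {A} {C} f f≤ (split D D⊆ _ _ ne g₁ g₂) C⊆A N≤k low | no heavy
    with ≤-total (weight f (C ─ D)) (weight f D)
  ... | inj₁ le = descend f f≤ g₁ (C⊆A ∘ D⊆) (≤-trans (p⊆q⇒∣p∣≤∣q∣ (N-part D⊆ ne)) N≤k)
          (sep-split {c = weight f C} {d = Δ} (≰⇒> heavy) (weight-cover f (p⊆q∪p─q D)) le)
  ... | inj₂ le = descend f f≤ g₂ (C⊆A ∘ x∈p─q⇒x∈p) (≤-trans (p⊆q⇒∣p∣≤∣q∣ (N-rest ne)) N≤k)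
          (sep-split {c = weight f C} {d = Δ} (≰⇒> heavy)
            (≤-trans (weight-cover f (p⊆q∪p─q D)) (≤-reflexive (+-comm (weight f D) _))) le)

  separate : ∀ {k A} (f : Fin ν → ℕ) → (∀ v → f v ≤ Δ) → Small k A → Balanced k f A
  separate {k} {A} f f≤ g = descend f f≤ g id (≤-trans (p⊆q⇒∣p∣≤∣q∣ nothing) (≤-trans (≤-reflexive (∣⊥∣≡0 ν)) z≤n))
    (≤-trans (m≤m+n (weight f A) _) (m≤m+n (3 * weight f A) _))
    where
    nothing : N A A ⊆ ⊥
    nothing x∈ = let x∈A , x∉A , _ = N⁻ x∈ in ⊥-elim (x∉A x∈A)

  -- Sweeping a set between two small sides

  module NoTwoLarge (w : ℕ) (one-small : ∀ X → Small w X ⊎ Small w (∁ X)) where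

    -- A bag of w + 1 vertices meets at most s edges.
    s : ℕ
    s = suc w * Δ

    Large Medium : Subset ν → Set
    Large X = ¬ Small w X
    Medium = Small (suc w)

    small⇒medium : ∀ {X} → Small w X → Medium X
    small⇒medium g = good-k-mono g (n≤1+n w)

    large-⊆ : ∀ {X Y} → Large X → X ⊆ Y → Large Y
    large-⊆ ¬s X⊆Y g = ¬s (small-⊆ g X⊆Y)

    disjoint⇒small : ∀ {X Y} → Large X → (∀ {v} → v ∈ Y → v ∉ X) → Small w Y
    disjoint⇒small {X} large disj with one-small X
    ... | inj₁ small = ⊥-elim (large small)
    ... | inj₂ small = small-⊆ small λ v∈Y → x∉p⇒x∈∁p (disj v∈Y)

    small-insert : ∀ {X Y} v → Small w X → Y ⊆ X ∪ ⁅ v ⁆ → Medium Y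
    small-insert {X} {Y} v g Y⊆ =
      subst (λ k → Small k Y) (trans (cong (w +_) (∣⁅x⁆∣≡1 v)) (+-comm w 1)) (small-∪ ⁅ v ⁆ g Y⊆)

    -- Vertices leave `Z` one at a time until the next removal would make the union small. It is
    -- then one vertex more than a small set; being still large, it forces its complement to be
    -- small.
    flip : ∀ P Z → Small w P → Large (P ∪ Z) → ∃ λ Z′ → Z′ ⊆ Z × Medium (P ∪ Z′) × Large (P ∪ Z′)
    flip P Z small = go ∣ Z ∣ Z ≤-refl
      where
      go : ∀ f Z → ∣ Z ∣ ≤ f → Large (P ∪ Z) → ∃ λ Z′ → Z′ ⊆ Z × Medium (P ∪ Z′) × Large (P ∪ Z′)
      go f Z ∣Z∣≤f large with nonempty? Z
      ... | no empty = ⊥-elim (large (small-⊆ small (∪-elim id λ x∈ → ⊥-elim (empty (_ , x∈)))))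
      go zero Z ∣Z∣≤0 large | yes (v , v∈) = ⊥-elim (n≮0 (<-≤-trans (x∈p⇒∣p-x∣<∣p∣ v∈) ∣Z∣≤0))
      go (suc f) Z ∣Z∣≤f large | yes (v , v∈) with good? w (P ∪ (Z - v)) (P ∪ (Z - v))
      ... | yes small′ = Z , id , small-insert v small′
              (∪-elim (λ x∈ → ∪ˡ (∪ˡ x∈)) λ x∈ → ∪-elim ∪ʳ (λ x∈ → ∪ˡ (∪ʳ x∈)) (p⊆q∪p─q ⁅ v ⁆ x∈)) , large
      ... | no large′ with go f (Z - v) (≤-pred (≤-trans (x∈p⇒∣p-x∣<∣p∣ v∈) ∣Z∣≤f)) large′
      ...   | Z′ , Z′⊆ , med , large″ = Z′ , x∈p─q⇒x∈p ∘ Z′⊆ , med , large″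

    b : Subset ν → ℕ
    b Y = e Y (∁ Y)

    κ : ℕ
    κ = 18 * (60 * s * Δ)

    -- Y is divided between P ⊆ Q and the complement of P ∪ Y. The weight b Y pays for the separators:
    -- it drops by a constant fraction at each bisection as long as it exceeds 60 s.
    Sweep : Subset ν → Subset ν → Set
    Sweep P Y = ∃ λ Q → P ⊆ Q × Q ⊆ P ∪ Y × Medium Q × Medium (∁ Q) × 18 * e (Y ∩ Q) (Y ─ Q) ≤ b Y + κ

    -- If `P ∪ ∂ Y` is small it is taken as `Q`: its complement falls into a small set and the
    -- interior of `Y`, with no edge between them. Otherwise `flip` stops inside `∂ Y`. Either way
    -- `Q` takes at most `60 * s` vertices from `Y`, and the edges at these are bounded by `κ`.
    sweep-final : ∀ {P Y} → Large (P ∪ Y) → Large (∁ P) → Medium Y → (∀ {v} → v ∈ Y → v ∉ P) →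
                  b Y ≤ 60 * s → Sweep P Y
    sweep-final {P} {Y} large large′ med disj b≤ = decide (good? w (P ∪ ∂Y) (P ∪ ∂Y))
      where
      ∂Y : Subset ν
      ∂Y = ∂ Y
      ∂⊆ : ∂Y ⊆ Y
      ∂⊆ = ∂⊆A
      smallP : Small w P
      smallP = disjoint⇒small large′ (x∈p⇒x∉∁p)
      smallR : Small w (∁ (P ∪ Y))
      smallR = disjoint⇒small large x∈∁p⇒x∉p
      few : ∀ {Q} → Y ∩ Q ⊆ ∂Y → 18 * e (Y ∩ Q) (Y ─ Q) ≤ b Y + κ
      few {Q} ⊆∂ = ≤-trans (*-monoʳ-≤ 18 (begin
        e (Y ∩ Q) (Y ─ Q)          ≤⟨ weight≤∣∣*k {X = Y ∩ Q} (weight≤Δ (Y ─ Q)) ⟩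
        ∣ Y ∩ Q ∣ * Δ              ≤⟨ *-monoˡ-≤ Δ (≤-trans (p⊆q⇒∣p∣≤∣q∣ ⊆∂) ∣∂∣≤) ⟩
        b Y * Δ                    ≤⟨ *-monoˡ-≤ Δ b≤ ⟩
        60 * s * Δ                 ∎)) (m≤n+m κ (b Y))
        where open ≤-Reasoning
      decide : Dec (Small w (P ∪ ∂Y)) → Sweep P Y
      decide (yes small) = P ∪ ∂Y , ∪ˡ , ∪-elim ∪ˡ (∪ʳ ∘ ∂⊆) , small⇒medium small ,
          small-⊔ {P = ∁ (P ∪ Y)} {Y ─ ∂Y} {∁ (P ∪ ∂Y)} (small⇒medium smallR) (small-⊆ med x∈p─q⇒x∈p)
            (λ x∈ → x∉p⇒x∈∁p (x∈∁p⇒x∉p x∈ ∘ ∪-elim ∪ˡ (∪ʳ ∘ ∂⊆)))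
            (λ x∈ → x∉p⇒x∈∁p (∪-elim (disj (x∈p─q⇒x∈p x∈)) (x∈p─q⇒x∉q x∈)))
            (⊆-by-cases Y (λ x∈ x∈Y → ∪ʳ (x∈p∧x∉q⇒x∈p─q x∈Y (x∈∁p⇒x∉p x∈ ∘ ∪ʳ)))
              λ x∈ x∉Y → ∪ˡ (x∉p⇒x∈∁p (∪-elim (x∈∁p⇒x∉p x∈ ∘ ∪ˡ) x∉Y)))
            (λ x∈R x∈Y → x∈∁p⇒x∉p x∈R (∪ʳ (x∈p─q⇒x∈p x∈Y)))
            (λ u∈R v∈ → trans (a-sym _ _) (interior v∈ (x∉p⇒x∈∁p (x∈∁p⇒x∉p u∈R ∘ ∪ʳ)))) ,
          few λ x∈ → ∪-elim (⊥-elim ∘ disj (p∩q⊆p Y _ x∈)) id (p∩q⊆q Y _ x∈)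
      decide (no large″) with flip P ∂Y smallP large″
      ... | Z , Z⊆ , medZ , largeZ = P ∪ Z , ∪ˡ , ∪-elim ∪ˡ (∪ʳ ∘ ∂⊆ ∘ Z⊆) , medZ ,
          small⇒medium (disjoint⇒small largeZ x∈∁p⇒x∉p) ,
          few λ x∈ → ∪-elim (⊥-elim ∘ disj (p∩q⊆p Y _ x∈)) Z⊆ (p∩q⊆q Y _ x∈)

    Δ≤s : Δ ≤ s
    Δ≤s = m≤m+n Δ (w * Δ)

    -- The two largeness hypotheses are the invariant: they keep `P` and the complement of `P ∪ Y`
    -- small. A balanced separator `D` halves `Y`, and the half that remains undecided is chosen so
    -- that the invariant persists.
    sweep : ∀ {P Y} → Large (P ∪ Y) → Large (∁ P) → Medium Y → (∀ {v} → v ∈ Y → v ∉ P) → Sweep P Y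
    sweep {P} {Y} = go (b Y) P Y ≤-refl
      where
      go : ∀ f P Y → b Y ≤ f → Large (P ∪ Y) → Large (∁ P) → Medium Y → (∀ {v} → v ∈ Y → v ∉ P) → Sweep P Y
      go zero P Y b≤f large large′ med disj = sweep-final large large′ med disj (≤-trans b≤f z≤n)
      go (suc f) P Y b≤f large large′ med disj with b Y ≤? 60 * s
      ... | yes b≤ = sweep-final large large′ med disj b≤
      ... | no b≰ = halve (separate (λ v → weight (a v) (∁ Y)) (weight≤Δ (∁ Y)) med)
        where
        b> : 60 * s < b Y
        b> = ≰⇒> b≰
        halve : Balanced (suc w) (λ v → weight (a v) (∁ Y)) Y → Sweep P Y
        halve (D , D⊆ , low , high , cut) with good? w (P ∪ D) (P ∪ D) | good? w (∁ (P ∪ D)) (∁ (P ∪ D))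
        -- Both sides are small already, so the sweep ends at the separator, which cuts at most `s`
        -- edges.
        ... | yes small | yes small′ = P ∪ D , ∪ˡ , ∪-elim ∪ˡ (∪ʳ ∘ D⊆) , small⇒medium small , small⇒medium small′ ,
          ≤-trans (*-monoʳ-≤ 18 (≤-trans (e-mono inner outer) cut))
            (≤-trans (*-monoˡ-≤ s {18} {60} (m≤m+n 18 42)) (≤-trans (<⇒≤ b>) (m≤m+n (b Y) κ)))
          where
          inner : Y ∩ (P ∪ D) ⊆ D
          inner x∈ = ∪-elim (⊥-elim ∘ disj (p∩q⊆p Y _ x∈)) id (p∩q⊆q Y _ x∈)
          outer : Y ─ (P ∪ D) ⊆ Y ─ D
          outer x∈ = x∈p∧x∉q⇒x∈p─q (x∈p─q⇒x∈p x∈) (x∈p─q⇒x∉q x∈ ∘ ∪ʳ)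
        -- `P ∪ D` is large, so `Y ─ D` joins the other side, which stays small, and `D` remains
        -- undecided.
        ... | no largeD | _ = extend (go f P D (≤-pred (≤-trans (part-decreases {b D} {b Y} {s} b> shrunk) b≤f))
                                largeD large′ (small-⊆ med D⊆) (disj ∘ D⊆))
          where
          shrunk : 3 * b D ≤ 2 * b Y + 6 * s
          shrunk = part-inside {b D} {b Y} {e D (∁ Y)} {e D (Y ─ D)} {s}
            (e-coverʳ D (⊆-by-cases Y (λ x∈ x∈Y → ∪ʳ (x∈p∧x∉q⇒x∈p─q x∈Y (x∈∁p⇒x∉p x∈))) λ _ x∉Y → ∪ˡ (x∉p⇒x∈∁p x∉Y)))
            high cut
          extend : Sweep P D → Sweep P Y
          extend (Q , P⊆ , Q⊆ , medQ , med∁Q , bound) =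
            Q , P⊆ , (λ x∈ → ∪-elim ∪ˡ (∪ʳ ∘ D⊆) (Q⊆ x∈)) , medQ , med∁Q ,
            sweep-step {e (Y ∩ Q) (Y ─ Q)} {e (D ∩ Q) (D ─ Q)} {e D (Y ─ D)} {b Y} {b D} {s} {κ} bound
              (≤-trans (e-coverʳ (Y ∩ Q) outer)
                (+-mono-≤ (e-mono inner id) (e-mono (λ x∈ → p∩q⊆p D Q (inner x∈)) id)))
              cut shrunk b>
            where
            inner : Y ∩ Q ⊆ D ∩ Q
            inner x∈ = let x∈Y , x∈Q = x∈p∩q⁻ Y Q x∈ in
              x∈p∩q⁺ (∪-elim (⊥-elim ∘ disj x∈Y) id (Q⊆ x∈Q) , x∈Q)
            outer : Y ─ Q ⊆ (D ─ Q) ∪ (Y ─ D)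
            outer = ⊆-by-cases D (λ x∈ x∈D → ∪ˡ (x∈p∧x∉q⇒x∈p─q x∈D (x∈p─q⇒x∉q x∈)))
              λ x∈ x∉D → ∪ʳ (x∈p∧x∉q⇒x∈p─q (x∈p─q⇒x∈p x∈) x∉D)
        -- The complement of `P ∪ D` is large, so `D` joins `P` and `Y ─ D` remains undecided.
        ... | yes _ | no largeR = extend (go f (P ∪ D) (Y ─ D)
                (≤-pred (≤-trans (part-decreases {b (Y ─ D)} {b Y} {s} b> shrunk) b≤f))
                (large-⊆ large (∪-elim (∪ˡ ∘ ∪ˡ) λ x∈ → ∪-elim (∪ˡ ∘ ∪ʳ) ∪ʳ (p⊆q∪p─q D x∈)))
                largeR (small-⊆ med x∈p─q⇒x∈p)
                (λ x∈ → ∪-elim (disj (x∈p─q⇒x∈p x∈)) (x∈p─q⇒x∉q x∈)))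
          where
          E : Subset ν
          E = Y ─ D
          shrunk : 3 * b E ≤ 2 * b Y + 6 * s
          shrunk = part-outside {b E} {b Y} {e D (∁ Y)} {e E (∁ Y)} {e D E} {s} {Δ}
            (≤-trans (e-coverʳ {Y = ∁ Y} {D} E (⊆-by-cases Y
                (λ x∈ x∈Y → case _ ∈? D of λ where
                  (yes x∈D) → ∪ʳ x∈D
                  (no x∉D) → ⊥-elim (x∈∁p⇒x∉p x∈ (x∈p∧x∉q⇒x∈p─q x∈Y x∉D)))
                λ _ x∉Y → ∪ˡ (x∉p⇒x∈∁p x∉Y)))
              (+-monoʳ-≤ (e E (∁ Y)) (≤-reflexive (e-sym E D))))
            (e-packˡ (∁ Y) D⊆ x∈p─q⇒x∈p λ x∈D x∈E → x∈p─q⇒x∉q x∈E x∈D) low Δ≤s cut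
          extend : Sweep (P ∪ D) E → Sweep P Y
          extend (Q , P⊆ , Q⊆ , medQ , med∁Q , bound) =
            Q , P⊆ ∘ ∪ˡ , (λ x∈ → ∪-elim (∪-elim ∪ˡ (∪ʳ ∘ D⊆)) (∪ʳ ∘ x∈p─q⇒x∈p) (Q⊆ x∈)) , medQ , med∁Q ,
            sweep-step {e (Y ∩ Q) (Y ─ Q)} {e (E ∩ Q) (E ─ Q)} {e D E} {b Y} {b E} {s} {κ} bound
              (≤-trans (e-coverˡ (Y ─ Q) inner)
                (+-mono-≤ (e-mono {E ∩ Q} id outer) (e-mono {D} id (x∈p─q⇒x∈p ∘ outer))))
              cut shrunk b>
            where
            outer : Y ─ Q ⊆ E ─ Q
            outer x∈ = x∈p∧x∉q⇒x∈p─q (x∈p∧x∉q⇒x∈p─q (x∈p─q⇒x∈p x∈) (x∈p─q⇒x∉q x∈ ∘ P⊆ ∘ ∪ʳ)) (x∈p─q⇒x∉q x∈)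
            inner : Y ∩ Q ⊆ (E ∩ Q) ∪ D
            inner x∈ = let x∈Y , x∈Q = x∈p∩q⁻ Y Q x∈ in case _ ∈? D of λ where
              (yes x∈D) → ∪ʳ x∈D
              (no x∉D) → ∪ˡ (x∈p∩q⁺ (x∈p∧x∉q⇒x∈p─q x∈Y x∉D , x∈Q))

    -- Exchanging halves of the two sides

    record Halves (A X Y : Subset ν) : Set where
      field
        X⊆A      : X ⊆ A
        Y⊆A      : Y ⊆ A
        A⊆X∪Y    : A ⊆ X ∪ Y
        disjoint : ∀ {v} → v ∈ X → v ∉ Y
        thin     : e X Y ≤ s
    open Halves

    halves-swap : ∀ {A X Y} → Halves A X Y → Halves A Y X
    halves-swap h .X⊆A = Y⊆A h
    halves-swap h .Y⊆A = X⊆A h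
    halves-swap h .A⊆X∪Y x∈ = ∪-elim ∪ʳ ∪ˡ (A⊆X∪Y h x∈)
    halves-swap h .disjoint y x = disjoint h x y
    halves-swap {X = X} {Y} h .thin = ≤-trans (≤-reflexive (e-sym Y X)) (thin h)

    Cut : (Subset ν → Set) → Set
    Cut P = ∃ λ Q → Medium Q × Medium (∁ Q) × P Q

    -- `Q` contains `A₂ ∪ B₂` and avoids `B₁`, and a sweep divides `A₁`. The edges between `A₂` and
    -- `B₂` cease to cross.
    swap : ∀ {A A₂ A₁ B₂ B₁} → Medium A → Medium (∁ A) → Halves A A₂ A₁ → Halves (∁ A) B₂ B₁ → Small w (A₂ ∪ B₂) →
           Cut λ Q → 18 * (b Q + e A₂ B₂) ≤ 19 * b A + 37 * s + κ
    swap {A} {A₂} {A₁} {B₂} {B₁} medA medB hA hB smallP with sweep-A₁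
      where
      P : Subset ν
      P = A₂ ∪ B₂
      disj : ∀ {v} → v ∈ A₁ → v ∉ P
      disj v∈ = ∪-elim (λ v∈A₂ → disjoint hA v∈A₂ v∈) (λ v∈B₂ → x∈∁p⇒x∉p (X⊆A hB v∈B₂) (Y⊆A hA v∈))
      nothing : ∀ {X Y} → (∀ {u v} → u ∈ X → v ∉ Y) → 18 * e X Y ≤ b A₁ + κ
      nothing {X} {Y} empty = subst (λ z → 18 * z ≤ b A₁ + κ)
        (sym (e-NoEdge {X} {Y} λ u∈ v∈ → ⊥-elim (empty u∈ v∈))) z≤n
      sweep-A₁ : Sweep P A₁
      sweep-A₁ with good? w (P ∪ A₁) (P ∪ A₁) | good? w (∁ P) (∁ P)
      -- Without the invariant of `sweep`, `A₁` can go to one side whole, and none of its inner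
      -- edges is cut.
      ... | yes small | _ = P ∪ A₁ , ∪ˡ , id , small⇒medium small ,
        small-⊆ medB (λ x∈ → x∉p⇒x∈∁p λ x∈A → x∈∁p⇒x∉p x∈ (∪-elim (∪ˡ ∘ ∪ˡ) ∪ʳ (A⊆X∪Y hA x∈A))) ,
        nothing {A₁ ∩ (P ∪ A₁)} λ _ v∈ → x∈p─q⇒x∉q v∈ (∪ʳ (x∈p─q⇒x∈p v∈))
      ... | no _ | yes small = P , id , ∪ˡ , small⇒medium smallP , small⇒medium small ,
        nothing {Y = A₁ ─ P} λ u∈ _ → disj (p∩q⊆p A₁ P u∈) (p∩q⊆q A₁ P u∈)
      ... | no large | no large′ = sweep large large′ (small-⊆ medA (Y⊆A hA)) disj
    ... | Q , P⊆Q , Q⊆ , medQ , med∁Q , bound = Q , medQ , med∁Q ,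
        swap-bound {b Q} {e A₂ B₂} {e A₂ B₁} {e A₁ B₂} {e A₁ B₁} {e (A₁ ∩ Q) (A₁ ─ Q)} {b A₁} {b A} {s} {κ}
          new old bound bA₁
      where
      B = ∁ A
      ∁Q⊆ : ∁ Q ⊆ (A₁ ─ Q) ∪ B₁
      ∁Q⊆ = ⊆-by-cases A
        (λ x∈ x∈A → ∪-elim (λ x∈A₂ → ⊥-elim (x∈∁p⇒x∉p x∈ (P⊆Q (∪ˡ x∈A₂))))
          (λ x∈A₁ → ∪ˡ (x∈p∧x∉q⇒x∈p─q x∈A₁ (x∈∁p⇒x∉p x∈)))
          (A⊆X∪Y hA x∈A))
        λ x∈ x∉A → ∪-elim (λ x∈B₂ → ⊥-elim (x∈∁p⇒x∉p x∈ (P⊆Q (∪ʳ x∈B₂)))) ∪ʳ (A⊆X∪Y hB (x∉p⇒x∈∁p x∉A))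
      Q⊆′ : Q ⊆ A₂ ∪ (B₂ ∪ (A₁ ∩ Q))
      Q⊆′ x∈ = ∪-elim (∪-elim ∪ˡ (∪ʳ ∘ ∪ˡ)) (λ x∈A₁ → ∪ʳ (∪ʳ (x∈p∩q⁺ (x∈A₁ , x∈)))) (Q⊆ x∈)
      -- The separators bound the edges from `A₂` to `A₁` and from `B₂` to `B₁` by `s` each.
      new : b Q ≤ (s + e A₂ B₁) + ((e A₁ B₂ + s) + (e (A₁ ∩ Q) (A₁ ─ Q) + e A₁ B₁))
      new = ≤-trans (e-coverˡ (∁ Q) Q⊆′) (+-mono-≤
        (≤-trans (e-coverʳ A₂ ∁Q⊆) (+-monoˡ-≤ (e A₂ B₁) (≤-trans (e-mono {A₂} id x∈p─q⇒x∈p) (thin hA))))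
        (≤-trans (e-coverˡ {Y = B₂} {A₁ ∩ Q} (∁ Q) id) (+-mono-≤
          (≤-trans (e-coverʳ B₂ ∁Q⊆) (+-mono-≤
            (≤-trans (e-mono {B₂} id x∈p─q⇒x∈p) (≤-reflexive (e-sym B₂ A₁))) (thin hB)))
          (≤-trans (e-coverʳ (A₁ ∩ Q) ∁Q⊆) (+-monoʳ-≤ (e (A₁ ∩ Q) (A₁ ─ Q)) (e-mono {Y = B₁} (p∩q⊆p A₁ Q) id))))))
      old : (e A₂ B₂ + e A₂ B₁) + (e A₁ B₂ + e A₁ B₁) ≤ b A
      old = ≤-trans
        (+-mono-≤ (e-packʳ A₂ (X⊆A hB) (Y⊆A hB) (disjoint hB)) (e-packʳ A₁ (X⊆A hB) (Y⊆A hB) (disjoint hB)))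
        (e-packˡ B (X⊆A hA) (Y⊆A hA) (disjoint hA))
      bA₁ : b A₁ ≤ b A + s
      bA₁ = ≤-trans (e-coverʳ {Y = B} {A₂} A₁ (⊆-by-cases A
              (λ x∈ x∈A → ∪-elim ∪ʳ (λ x∈A₁ → ⊥-elim (x∈∁p⇒x∉p x∈ x∈A₁)) (A⊆X∪Y hA x∈A)) λ _ x∉A → ∪ˡ (x∉p⇒x∈∁p x∉A)))
            (+-mono-≤ (e-mono {Y = B} (Y⊆A hA) id) (thin (halves-swap hA)))

    module Descent (1≤Δ : 1 ≤ Δ) where

      -- `A₂ ∪ B₂` and `A₁ ∪ B₁` are disjoint, so one of them is small and can be swapped. As either
      -- may occur, both diagonals must carry many edges.
      improve-diagonal : ∀ {A A₂ A₁ B₂ B₁} → Medium A → Medium (∁ A) → 1141 * (s * Δ) < b A →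
                         Halves A A₂ A₁ → Halves (∁ A) B₂ B₁ →
                         b A ≤ 9 * e A₂ B₂ + 12 * Δ → b A ≤ 9 * e A₁ B₁ + 12 * Δ → Cut λ Q → b Q < b A
      improve-diagonal {A} {A₂} {A₁} {B₂} {B₁} medA medB large hA hB gain₂ gain₁ with good? w (A₂ ∪ B₂) (A₂ ∪ B₂)
      ... | yes small = let Q , medQ , med∁Q , bound = swap medA medB hA hB small in
        Q , medQ , med∁Q , swap-decreases {b Q} {e A₂ B₂} {b A} {s} {Δ} bound gain₂ 1≤Δ (≤-trans 1≤Δ Δ≤s) large
      ... | no ¬small =
        let Q , medQ , med∁Q , bound = swap medA medB (halves-swap hA) (halves-swap hB)
              (disjoint⇒small ¬small opposite)
        in Q , medQ , med∁Q , swap-decreases {b Q} {e A₁ B₁} {b A} {s} {Δ} bound gain₁ 1≤Δ (≤-trans 1≤Δ Δ≤s) large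
        where
        opposite : ∀ {v} → v ∈ A₁ ∪ B₁ → v ∉ A₂ ∪ B₂
        opposite = ∪-elim
          (λ v∈A₁ → ∪-elim (λ v∈A₂ → disjoint hA v∈A₂ v∈A₁) (λ v∈B₂ → x∈∁p⇒x∉p (X⊆A hB v∈B₂) (Y⊆A hA v∈A₁)))
          (λ v∈B₁ → ∪-elim (λ v∈A₂ → x∈∁p⇒x∉p (Y⊆A hB v∈B₁) (X⊆A hA v∈A₂)) (λ v∈B₂ → disjoint hB v∈B₂ v∈B₁))

      balanced⇒halves : ∀ {f A} ((D , _) : Balanced (suc w) f A) → Halves A D (A ─ D)
      balanced⇒halves (D , D⊆ , _) .X⊆A = D⊆
      balanced⇒halves (D , _) .Y⊆A = x∈p─q⇒x∈p
      balanced⇒halves (D , _) .A⊆X∪Y = p⊆q∪p─q D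
      balanced⇒halves (D , _) .disjoint v∈D v∈ = x∈p─q⇒x∉q v∈ v∈D
      balanced⇒halves (_ , _ , _ , _ , cut) .thin = cut

      -- `B` is bisected by its edges to `A₂` alone, so `A₂` sends many edges to both halves of `B`.
      -- The diagonal can then be chosen to join `A₁` with the half to which it sends more.
      improve : ∀ {A} → Medium A → Medium (∁ A) → 1141 * (s * Δ) < b A → Cut λ Q → b Q < b A
      improve {A} medA medB large
        with sepA@(A₂ , A₂⊆ , lowA , highA , _) ← separate (λ v → weight (a v) (∁ A)) (weight≤Δ (∁ A)) medA
        with sepB@(B₂ , B₂⊆ , lowB , highB , _) ← separate (λ v → weight (a v) A₂) (weight≤Δ A₂) medB
        = choose (≤-total (e A₁ B₂) (e A₁ B₁))
        where
        B = ∁ A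
        A₁ = A ─ A₂
        B₁ = B ─ B₂
        hA = balanced⇒halves sepA
        hB = balanced⇒halves sepB
        lowB′ : e A₂ B ≤ 3 * e A₂ B₂ + 3 * Δ
        lowB′ = subst₂ (λ x y → x ≤ 3 * y + 3 * Δ) (e-sym B A₂) (e-sym B₂ A₂) lowB
        highB′ : 3 * e A₂ B₂ ≤ 2 * e A₂ B
        highB′ = subst₂ (λ x y → 3 * y ≤ 2 * x) (e-sym B A₂) (e-sym B₂ A₂) highB
        gain₂₂ : b A ≤ 9 * e A₂ B₂ + 12 * Δ
        gain₂₂ = gain-of-part {b A} {e A₂ B} {e A₂ B₂} {Δ} lowA lowB′
        gain₂₁ : b A ≤ 9 * e A₂ B₁ + 12 * Δ
        gain₂₁ = gain-of-part {b A} {e A₂ B} {e A₂ B₁} {Δ} lowA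
          (≤-trans (complement-heavy {e A₂ B} {e A₂ B₂} {e A₂ B₁} (e-coverʳ A₂ (p⊆q∪p─q B₂)) highB′)
            (m≤m+n _ (3 * Δ)))
        heavy₁ : b A ≤ 3 * e A₁ B
        heavy₁ = complement-heavy {b A} {e A₂ B} {e A₁ B} (e-coverˡ B (p⊆q∪p─q A₂)) highA
        A₁B≤ : e A₁ B ≤ e A₁ B₂ + e A₁ B₁
        A₁B≤ = e-coverʳ A₁ (p⊆q∪p─q B₂)
        choose : e A₁ B₂ ≤ e A₁ B₁ ⊎ e A₁ B₁ ≤ e A₁ B₂ → Cut λ Q → b Q < b A
        choose (inj₁ le) = improve-diagonal medA medB large hA hB gain₂₂
          (gain-of-larger {b A} {e A₁ B} {e A₁ B₁} {e A₁ B₂} {Δ} heavy₁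
            (≤-trans A₁B≤ (≤-reflexive (+-comm (e A₁ B₂) (e A₁ B₁)))) le)
        choose (inj₂ le) = improve-diagonal medA medB large hA (halves-swap hB) gain₂₁
          (gain-of-larger {b A} {e A₁ B} {e A₁ B₂} {e A₁ B₁} {Δ} heavy₁ A₁B≤ le)

      initial-cut : ∃ λ A → Medium A × Medium (∁ A)
      initial-cut with good? w ⊤ ⊤
      ... | yes small = ⊤ , small⇒medium small , small-⊆ (small⇒medium small) (λ _ → ∈⊤)
      ... | no large with flip ⊥ ⊤ (done λ (_ , x∈) → ∉⊥ x∈) (large-⊆ large ∪ʳ)
      ...   | Z , _ , med , large′ = ⊥ ∪ Z , med , small⇒medium (disjoint⇒small large′ x∈∁p⇒x∉p)

      small-cut : ∃ λ A → Medium A × Medium (∁ A) × b A ≤ 1141 * (s * Δ)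
      small-cut = let A , medA , medB = initial-cut in go (b A) A ≤-refl medA medB
        where
        go : ∀ f A → b A ≤ f → Medium A → Medium (∁ A) → ∃ λ A → Medium A × Medium (∁ A) × b A ≤ 1141 * (s * Δ)
        go f A b≤f medA medB with b A ≤? 1141 * (s * Δ)
        ... | yes small = A , medA , medB , small
        go zero A b≤f medA medB | no large = ⊥-elim (large (≤-trans b≤f z≤n))
        go (suc f) A b≤f medA medB | no large =
          let Q , medQ , med∁Q , lt = improve medA medB (≰⇒> large) in go f Q (≤-pred (≤-trans lt b≤f)) medQ med∁Q

      -- Without `∂ A` no edge joins the two medium sides. Restoring these vertices enlarges the
      -- bags by at most the number of crossing edges.
      whole-small : Small (suc w + 1141 * (s * Δ)) ⊤
      whole-small with small-cut
      ... | A , medA , medB , b≤ = good-k-mono (small-∪ (∂ A) inner (λ {x} _ → cover x))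
              (+-monoʳ-≤ (suc w) (≤-trans (∣∂∣≤ {A}) b≤))
        where
        inner : Medium ((A ─ ∂ A) ∪ ∁ A)
        inner = small-⊔ (small-⊆ medA x∈p─q⇒x∈p) medB ∪ˡ ∪ʳ id (λ x∈ → x∈p⇒x∉∁p (x∈p─q⇒x∈p x∈)) interior
        cover : ∀ x → x ∈ ((A ─ ∂ A) ∪ ∁ A) ∪ ∂ A
        cover x with x ∈? A | x ∈? ∂ A
        ... | no x∉A | _ = ∪ˡ (∪ʳ (x∉p⇒x∈∁p x∉A))
        ... | yes _ | yes x∈∂ = ∪ʳ x∈∂
        ... | yes x∈A | no x∉∂ = ∪ˡ (∪ˡ (x∈p∧x∉q⇒x∈p─q x∈A x∉∂))

-- The constant and the conclusion

*-div≤ : ∀ a b → (a div b) * b ≤ a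
*-div≤ a zero = z≤n
*-div≤ a (suc b) = m/n*n≤m a (suc b)

-- For `Δ = 0` the divisor is zero and `div` returns its default value `0`.
div-zero-or-positive : ∀ a Δ → a div (2284 * (Δ * Δ)) ≡ 0 ⊎ 1 ≤ Δ
div-zero-or-positive a zero = inj₁ refl
div-zero-or-positive a (suc Δ) = inj₂ (s≤s z≤n)

-- `2284 = 2 * 1141 + 2`: bounding `suc w` by `w + w` doubles `1141`, one more multiple of
-- `w * (Δ * Δ)` absorbs the summand `w`, and the last makes the inequality strict.
width-too-small : ∀ w Δ → 1 ≤ w → 1 ≤ Δ → w + 1141 * (suc w * Δ * Δ) < w * (2284 * (Δ * Δ))
width-too-small w Δ 1≤w 1≤Δ = begin-strict
  w + 1141 * (suc w * Δ * Δ)          ≤⟨ +-mono-≤ w≤ (*-monoʳ-≤ 1141 (*-monoˡ-≤ Δ (*-monoˡ-≤ Δ (+-monoˡ-≤ w 1≤w)))) ⟩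
  x + 1141 * ((w + w) * Δ * Δ)        <⟨ m<n+m _ (≤-trans 1≤w w≤) ⟩
  x + (x + 1141 * ((w + w) * Δ * Δ))  ≡⟨ eq w Δ ⟩
  w * (2284 * (Δ * Δ))                ∎
  where
  open ≤-Reasoning
  x = w * (Δ * Δ)
  w≤ : w ≤ x
  w≤ = m≤m*n w (Δ * Δ) {{ℕ.>-nonZero (*-mono-≤ 1≤Δ 1≤Δ)}}
  eq : ∀ w Δ → w * (Δ * Δ) + (w * (Δ * Δ) + 1141 * ((w + w) * Δ * Δ)) ≡ w * (2284 * (Δ * Δ))
  eq = solve-∀

Splitting : Graph → ℕ → Set
Splitting G w = Σ (Subset (n G)) λ A → Σ (Subset (n G)) λ B → IsPartition G A B × TwAtLeast G A w × TwAtLeast G B w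

complementary : ∀ G (A : Subset (n G)) → IsPartition G A (∁ A)
complementary G A = covers-all , λ v → x∈p⇒x∉∁p
  where
  covers-all : ∀ v → v ∈ A ⊎ v ∈ ∁ A
  covers-all v with v ∈? A
  ... | yes v∈ = inj₁ v∈
  ... | no v∉ = inj₂ (x∉p⇒x∈∁p v∉)

-- A search through all subsets finds two large complementary sides or supplies the hypothesis of
-- `NoTwoLarge`, under which the whole graph has too small a treewidth.
splitting : ∀ {Δ t w} G → MaxDegreeAtMost G Δ → TwAtLeast G ⊤ t → 1 ≤ Δ → 1 ≤ w →
            w * (2284 * (Δ * Δ)) ≤ t → Splitting G w
splitting {Δ} {t} {w} G deg tw 1≤Δ 1≤w w≤ with anySubset? both-large?
  where
  open EdgeWeights (multiplicity (edges G)) (multiplicity-sym (edges G))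
  both-large? : ∀ A → Dec (¬ Small w A × ¬ Small w (∁ A))
  both-large? A = ¬? (good? w A A) ×-dec ¬? (good? w (∁ A) (∁ A))
... | yes (A , largeA , largeB) = A , ∁ A , complementary G A ,
      large⇒TwAtLeast G A w largeA , large⇒TwAtLeast G (∁ A) w largeB
... | no none = ⊥-elim (<⇒≱ (width-too-small w Δ 1≤w 1≤Δ) (≤-trans w≤ (≤-trans (tw D) D≤)))
  where
  a = multiplicity (edges G)
  a-sym = multiplicity-sym (edges G)
  open EdgeWeights a a-sym
  one-small : ∀ X → Small w X ⊎ Small w (∁ X)
  one-small X with good? w X X | good? w (∁ X) (∁ X)
  ... | yes small | _ = inj₁ small
  ... | no _ | yes small = inj₂ small
  ... | no large | no large′ = ⊥-elim (none (X , large , large′))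
  open BoundedDegree a a-sym Δ (λ u → ≤-trans (sum-multiplicity≤degree G u) (deg u))
  decomposition = ToTD.small⇒decomposition G _ (NoTwoLarge.Descent.whole-small w one-small 1≤Δ)
  D = proj₁ decomposition
  -- Width is bag size minus one, so `suc w` has become `w`.
  D≤ : width D ≤ w + 1141 * (suc w * Δ * Δ)
  D≤ = proj₂ decomposition

theorem4 : Σ ℕ (λ p → Σ ℕ (λ q → (0 < p) × (p ≤ q) ×
    ((Δ : ℕ) (G : Graph) → MaxDegreeAtMost G Δ →
    (t : ℕ) → Treewidth G t →
    Σ (Subset (n G)) (λ A → Σ (Subset (n G)) (λ B →
    IsPartition G A B ×
    TwAtLeast G A ((p * t) div (q * (Δ * Δ))) ×
    TwAtLeast G B ((p * t) div (q * (Δ * Δ))))))))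
theorem4 = 1 , 2284 , s≤s z≤n , s≤s z≤n , λ Δ G deg t (_ , tw) → split-by-width Δ G deg t tw
  where
  split-by-width : ∀ Δ G → MaxDegreeAtMost G Δ → ∀ t → TwAtLeast G ⊤ t → Splitting G ((1 * t) div (2284 * (Δ * Δ)))
  split-by-width Δ G deg t tw with (1 * t) div (2284 * (Δ * Δ)) in eq | div-zero-or-positive (1 * t) Δ
  -- For target `0` any partition will do.
  ... | zero | _ = ⊤ , ∁ ⊤ , complementary G ⊤ , (λ _ → z≤n) , (λ _ → z≤n)
  ... | suc w | inj₂ 1≤Δ = splitting G deg tw 1≤Δ (s≤s z≤n)
        (≤-trans (subst (λ w → w * (2284 * (Δ * Δ)) ≤ 1 * t) eq (*-div≤ (1 * t) (2284 * (Δ * Δ))))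
          (≤-reflexive (*-identityˡ t)))
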